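{- Let $G=(V,E)$ be a finite graph with $d$ vertices, with multiple edges and loops allowed. Then $$A_G(V)=\sum_{S\subseteq E}(-1)^{s(S)}\prod_{C\in\mathcal{C}(S)}v_C .$$ Hence, $$a_G(t)=\sum_{S\subseteq E}(-1)^{s(S)}\prod_{C\in\mathcal{C}(S)}\big(1-(1-t)^{|V(C)|}\big).$$
   Context: Graphs are finite and may have multiple edges and loops. An orientation of $G$ assigns a direction to each edge; it is acyclic if it has no directed cycles (so a graph with a loop has no acyclic orientation). $\mathcal{A}(G)$ is the set of acyclic orientations of $G$. For $\mathfrak{o}\in\mathcal{A}(G)$, a vertex $v$ is a sink if every edge incident with $v$ is directed toward $v$ (in particular, isolated vertices are sinks); $\operatorname{Sink}(\mathfrak{o})$ is the set of sinks of $\mathfrak{o}$ and $\operatorname{sink}(\mathfrak{o})=|\operatorname{Sink}(\mathfrak{o})|$. To each vertex $v\in V$ associate a commuting variable, also denoted $v$, and let $\mathbb{Z}[V]$ be the polynomial ring in these variables. The acyclic orientation polynomial of $G$ is $$A_G(V)=\sum_{\mathfrak{o}\in\mathcal{A}(G)}\ \prod_{v\in\operatorname{Sink}(\mathfrak{o})}v\ \in\mathbb{Z}[V],$$ and $a_G(t)=\sum_{\mathfrak{o}\in\mathcal{A}(G)}t^{\operatorname{sink}(\mathfrak{o})}$ is obtained from it by setting $v=t$ for every $v\in V$. A subset $S\subseteq E$ is identified with the spanning subgraph of $G$ with vertex set $V$ and edge set $S$; $|S|$ is its number of edges, $\mathcal{C}(S)$ is its set of connected components, and $s(S)=|S|-d+|\mathcal{C}(S)|$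 is its corank. For a connected component $C$ with vertex set $V(C)$, put $$v_C=1-\prod_{v\in V(C)}(1-v)\in\mathbb{Z}[V].$$ -}

module Defs where

open import Algebra.Bundles using (CommutativeRing)
import Algebra.Properties.Semiring.Exp as Exp
open import Data.Bool.Base using (Bool; true; false; if_then_else_)
open import Data.Fin.Base using (Fin; zero; suc)
import Data.Fin.Properties as Fin
open import Data.Fin.Subset using (Subset; _∈_) renaming (∣_∣ to size)
open import Data.Fin.Subset.Properties using (_∈?_)
open import Data.Integer.Base as ℤ using (ℤ; +_; 0ℤ; 1ℤ)
import Data.Integer.Properties as ℤ
open import Data.Integer.Tactic.RingSolver using (solve-∀)
open import Data.List.Base as List
  using (List; []; _∷_; _++_; _∷ʳ_; map; foldr; filter; length; allFin;
         cartesianProduct; cartesianProductWith)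
import Data.List.Properties as List
import Data.List.Membership.Propositional as Mem
open import Data.List.Membership.Propositional.Properties
  using (∈-filter⁺; ∈-filter⁻; ∈-cartesianProduct⁺; ∈-allFin)
open import Data.List.Relation.Unary.All using ([]; _∷_)
import Data.List.Relation.Unary.All.Properties as All
open import Data.List.Relation.Unary.AllPairs using ([]; _∷_)
open import Data.List.Relation.Unary.Any using (here; there; any?)
open import Data.List.Relation.Unary.Linked using (Linked; []; [-]; _∷_)
open import Data.List.Relation.Unary.Unique.Propositional using (Unique)
open import Data.Nat.Base as ℕ using (ℕ; zero; suc)
import Data.Nat.Properties as ℕ
open import Data.Product.Base using (Σ; ∃; ∃₂; _×_; _,_; proj₁; proj₂)
open import Data.Product.Properties using (≡-dec)
open import Data.Sum.Base using (_⊎_; inj₁; inj₂)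
open import Data.Vec.Base as Vec using (Vec; []; _∷_; lookup)
import Data.Vec.Properties as Vec
open import Function.Base using (_∘_; id)
open import Function.Bundles using (_⇔_; mk⇔; Equivalence)
open import Level using (0ℓ)
open import Relation.Binary.Construct.Closure.Equivalence using (EqClosure)
open import Relation.Binary.Construct.Closure.ReflexiveTransitive as Star
  using (Star; ε; _◅_; _◅◅_)
open import Relation.Binary.Construct.Closure.Symmetric using (SymClosure; fwd; bwd)
open import Relation.Binary.Core using (Rel)
open import Relation.Binary.Definitions using () renaming (Decidable to Decidable₂)
open import Relation.Binary.PropositionalEquality
open import Relation.Nullary.Decidable
  using (Dec; yes; no; does; ¬?; map′; _×-dec_; _⊎-dec_; _→-dec_; dec-true; dec-false)
open import Relation.Nullary.Negation using (¬_; contradiction)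
open import Relation.Unary using (Pred) renaming (Decidable to Decidable₁)

-- A monomial is its vector of exponents.
Monomial : ℕ → Set
Monomial n = Vec ℕ n

-- A formal sum of terms c · xᵘ.  Monomials may repeat and coefficients may
-- vanish; two such sums are the same polynomial when all their
-- coefficients agree (_≈_ below).
Polynomial : ℕ → Set
Polynomial n = List (ℤ × Monomial n)

_≟ᵐ_ : ∀ {n} (μ ν : Monomial n) → Dec (μ ≡ ν)
_≟ᵐ_ = Vec.≡-dec ℕ._≟_

infixr 7 _·ᵐ_
_·ᵐ_ : ∀ {n} → Monomial n → Monomial n → Monomial n
_·ᵐ_ = Vec.zipWith ℕ._+_

1ᵐ : ∀ {n} → Monomial n
1ᵐ = Vec.replicate _ 0

coeff : ∀ {n} → Polynomial n → Monomial n → ℤ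
coeff []            μ = 0ℤ
coeff ((c , ν) ∷ p) μ = (if does (ν ≟ᵐ μ) then c else 0ℤ) ℤ.+ coeff p μ

infix  4 _≈_
infixl 6 _+_ _-_
infixl 7 _*_
infix  8 -_

record _≈_ {n} (p q : Polynomial n) : Set where
  constructor mk≈
  field coeff-≡ : ∀ μ → coeff p μ ≡ coeff q μ
open _≈_ public

0# 1# : ∀ {n} → Polynomial n
0# = []
1# = (1ℤ , 1ᵐ) ∷ []

_+_ : ∀ {n} → Polynomial n → Polynomial n → Polynomial n
_+_ = _++_

-_ : ∀ {n} → Polynomial n → Polynomial n
-_ = map λ (c , μ) → ℤ.- c , μ

_-_ : ∀ {n} → Polynomial n → Polynomial n → Polynomial n
p - q = p + (- q)

_*_ : ∀ {n} → Polynomial n → Polynomial n → Polynomial n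
_*_ = cartesianProductWith λ (c , μ) (c′ , ν) → c ℤ.* c′ , μ ·ᵐ ν

var : ∀ {n} → Fin n → Polynomial n
var i = (1ℤ , 1ᵐ Vec.[ i ]≔ 1) ∷ []

module PolynomialRing {n : ℕ} where

  private
    variable
      p q r p′ q′ : Polynomial n

    δ : Monomial n → Monomial n → ℤ
    δ μ ν = if does (ν ≟ᵐ μ) then 1ℤ else 0ℤ

    ·ᵐ-comm : (μ ν : Monomial n) → μ ·ᵐ ν ≡ ν ·ᵐ μ
    ·ᵐ-comm = Vec.zipWith-comm ℕ.+-comm

    ·ᵐ-assoc : (μ ν ρ : Monomial n) → (μ ·ᵐ ν) ·ᵐ ρ ≡ μ ·ᵐ ν ·ᵐ ρ
    ·ᵐ-assoc = Vec.zipWith-assoc ℕ.+-assoc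

    ·ᵐ-identityˡ : (μ : Monomial n) → 1ᵐ ·ᵐ μ ≡ μ
    ·ᵐ-identityˡ = Vec.zipWith-identityˡ ℕ.+-identityˡ

    ·ᵐ-cancelˡ : ∀ {k} (μ : Monomial k) {ν ρ} → μ ·ᵐ ν ≡ μ ·ᵐ ρ → ν ≡ ρ
    ·ᵐ-cancelˡ []      {[]}    {[]}    _  = refl
    ·ᵐ-cancelˡ (x ∷ μ) {y ∷ ν} {z ∷ ρ} eq =
      cong₂ _∷_ (ℕ.+-cancelˡ-≡ x y z (cong Vec.head eq))
                (·ᵐ-cancelˡ μ (cong Vec.tail eq))

    divide? : ∀ {k} (μ ν : Monomial k) → Dec (∃ λ ρ → μ ·ᵐ ρ ≡ ν)
    divide? [] [] = yes ([] , refl)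
    divide? (x ∷ μ) (y ∷ ν) with x ℕ.≤? y | divide? μ ν
    ... | yes x≤y | yes (ρ , eq) = yes (y ℕ.∸ x ∷ ρ , cong₂ _∷_ (ℕ.m+[n∸m]≡n x≤y) eq)
    ... | no  x≰y | _      = no λ where
      (z ∷ _ , eq) → x≰y (subst (x ℕ.≤_) (cong Vec.head eq) (ℕ.m≤m+n x z))
    ... | yes _   | no ∤   = no λ where
      (_ ∷ ρ , eq) → ∤ (ρ , cong Vec.tail eq)

    -- The ℤ-linear functional on polynomials with given values on monomials.
    ∫ : Polynomial n → (Monomial n → ℤ) → ℤ
    ∫ []            f = 0ℤ
    ∫ ((c , ν) ∷ p) f = c ℤ.* f ν ℤ.+ ∫ p f

    coeff-∫ : ∀ (p : Polynomial n) μ → coeff p μ ≡ ∫ p (δ μ)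
    coeff-∫ []            μ = refl
    coeff-∫ ((c , ν) ∷ p) μ = cong₂ ℤ._+_ (head (does (ν ≟ᵐ μ))) (coeff-∫ p μ)
      where
      head : ∀ b → (if b then c else 0ℤ) ≡ c ℤ.* (if b then 1ℤ else 0ℤ)
      head true  = sym (ℤ.*-identityʳ c)
      head false = sym (ℤ.*-zeroʳ c)

    ∫-cong : ∀ p {f g : Monomial n → ℤ} → (∀ μ → f μ ≡ g μ) → ∫ p f ≡ ∫ p g
    ∫-cong []            f≗g = refl
    ∫-cong ((c , ν) ∷ p) f≗g = cong₂ ℤ._+_ (cong (c ℤ.*_) (f≗g ν)) (∫-cong p f≗g)

    ∫-0 : ∀ p → ∫ p (λ _ → 0ℤ) ≡ 0ℤ
    ∫-0 []            = refl
    ∫-0 ((c , _) ∷ p) = cong₂ ℤ._+_ (ℤ.*-zeroʳ c) (∫-0 p)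

    ∫-++ : ∀ p q (f : Monomial n → ℤ) → ∫ (p ++ q) f ≡ ∫ p f ℤ.+ ∫ q f
    ∫-++ []            q f = sym (ℤ.+-identityˡ _)
    ∫-++ ((c , ν) ∷ p) q f =
      trans (cong (ℤ._+_ (c ℤ.* f ν)) (∫-++ p q f)) (sym (ℤ.+-assoc (c ℤ.* f ν) _ _))

    ∫-neg : ∀ p (f : Monomial n → ℤ) → ∫ (- p) f ≡ ℤ.- ∫ p f
    ∫-neg []            f = refl
    ∫-neg ((c , ν) ∷ p) f =
      trans (cong (ℤ._+_ (ℤ.- c ℤ.* f ν)) (∫-neg p f)) (lemma c (f ν) (∫ p f))
      where
      lemma : ∀ x y z → ℤ.- x ℤ.* y ℤ.+ ℤ.- z ≡ ℤ.- (x ℤ.* y ℤ.+ z)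
      lemma = solve-∀

    ∫-scale : ∀ c p (f : Monomial n → ℤ) → c ℤ.* ∫ p f ≡ ∫ p (λ μ → c ℤ.* f μ)
    ∫-scale c []            f = ℤ.*-zeroʳ c
    ∫-scale c ((b , ν) ∷ p) f =
      trans (lemma c b (f ν) (∫ p f)) (cong (ℤ._+_ (b ℤ.* (c ℤ.* f ν))) (∫-scale c p f))
      where
      lemma : ∀ x y z w → x ℤ.* (y ℤ.* z ℤ.+ w) ≡ y ℤ.* (x ℤ.* z) ℤ.+ x ℤ.* w
      lemma = solve-∀

    ∫-+ : ∀ p (f g : Monomial n → ℤ) → ∫ p (λ μ → f μ ℤ.+ g μ) ≡ ∫ p f ℤ.+ ∫ p g
    ∫-+ []            f g = refl
    ∫-+ ((c , ν) ∷ p) f g =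
      trans (cong (ℤ._+_ (c ℤ.* (f ν ℤ.+ g ν))) (∫-+ p f g))
            (lemma c (f ν) (g ν) (∫ p f) (∫ p g))
      where
      lemma : ∀ x y z u v →
              x ℤ.* (y ℤ.+ z) ℤ.+ (u ℤ.+ v) ≡ (x ℤ.* y ℤ.+ u) ℤ.+ (x ℤ.* z ℤ.+ v)
      lemma = solve-∀

    ∫-swap : ∀ p q (f : Monomial n → Monomial n → ℤ) →
             ∫ p (λ μ → ∫ q (f μ)) ≡ ∫ q (λ ν → ∫ p (λ μ → f μ ν))
    ∫-swap []            q f = sym (∫-0 q)
    ∫-swap ((c , μ) ∷ p) q f =
      trans (cong₂ ℤ._+_ (∫-scale c q (f μ)) (∫-swap p q f)) (sym (∫-+ q _ _))

    ∫-map : ∀ c μ q (f : Monomial n → ℤ) →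
            ∫ (map (λ (c′ , ν) → c ℤ.* c′ , μ ·ᵐ ν) q) f ≡ c ℤ.* ∫ q (λ ν → f (μ ·ᵐ ν))
    ∫-map c μ []            f = sym (ℤ.*-zeroʳ c)
    ∫-map c μ ((b , ν) ∷ q) f =
      trans (cong (ℤ._+_ (c ℤ.* b ℤ.* f (μ ·ᵐ ν))) (∫-map c μ q f))
            (lemma c b (f (μ ·ᵐ ν)) _)
      where
      lemma : ∀ x y z w → x ℤ.* y ℤ.* z ℤ.+ x ℤ.* w ≡ x ℤ.* (y ℤ.* z ℤ.+ w)
      lemma = solve-∀

    ∫-* : ∀ p q (f : Monomial n → ℤ) → ∫ (p * q) f ≡ ∫ p (λ μ → ∫ q (λ ν → f (μ ·ᵐ ν)))
    ∫-* []            q f = refl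
    ∫-* ((c , μ) ∷ p) q f =
      trans (∫-++ (map _ q) (p * q) f) (cong₂ ℤ._+_ (∫-map c μ q f) (∫-* p q f))

    to : (∀ f → ∫ p f ≡ ∫ q f) → p ≈ q
    to {p} {q} h = mk≈ λ μ → trans (coeff-∫ p μ) (trans (h (δ μ)) (sym (coeff-∫ q μ)))

    from : p ≈ q → ∀ μ → ∫ p (δ μ) ≡ ∫ q (δ μ)
    from {p} {q} h μ = trans (sym (coeff-∫ p μ)) (trans (coeff-≡ h μ) (coeff-∫ q μ))

    δ-shift : ∀ ν ρ μ → δ (ν ·ᵐ ρ) (ν ·ᵐ μ) ≡ δ ρ μ
    δ-shift ν ρ μ with μ ≟ᵐ ρ
    ... | yes refl rewrite dec-true ((ν ·ᵐ ρ) ≟ᵐ (ν ·ᵐ ρ)) refl = refl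
    ... | no μ≢ρ rewrite dec-false ((ν ·ᵐ μ) ≟ᵐ (ν ·ᵐ ρ)) (μ≢ρ ∘ ·ᵐ-cancelˡ ν) = refl

    δ-≢ : ∀ {μ ν} → ν ≢ μ → δ μ ν ≡ 0ℤ
    δ-≢ {μ} {ν} ν≢μ rewrite dec-false (ν ≟ᵐ μ) ν≢μ = refl

    ∫-shift : p ≈ q → ∀ ν μ → ∫ p (δ μ ∘ (ν ·ᵐ_)) ≡ ∫ q (δ μ ∘ (ν ·ᵐ_))
    ∫-shift {p} {q} p≈q ν μ with divide? ν μ
    ... | yes (ρ , refl) =
      trans (∫-cong p (δ-shift ν ρ)) (trans (from p≈q ρ) (sym (∫-cong q (δ-shift ν ρ))))
    ... | no ν∤μ = trans (vanish p) (sym (vanish q))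
      where
      vanish : ∀ p → ∫ p (δ μ ∘ (ν ·ᵐ_)) ≡ 0ℤ
      vanish p = trans (∫-cong p (λ ρ → δ-≢ (λ eq → ν∤μ (ρ , eq)))) (∫-0 p)

  ≈-refl : p ≈ p
  ≈-refl = mk≈ λ _ → refl

  ≈-sym : p ≈ q → q ≈ p
  ≈-sym h = mk≈ λ μ → sym (coeff-≡ h μ)

  ≈-trans : p ≈ q → q ≈ r → p ≈ r
  ≈-trans h k = mk≈ λ μ → trans (coeff-≡ h μ) (coeff-≡ k μ)

  ≡⇒≈ : p ≡ q → p ≈ q
  ≡⇒≈ refl = ≈-refl

  +-cong : p ≈ p′ → q ≈ q′ → p + q ≈ p′ + q′
  +-cong {p} {p′} {q} {q′} h k = mk≈ λ μ → begin
    coeff (p + q) μ                 ≡⟨ coeff-∫ (p + q) μ ⟩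
    ∫ (p + q) (δ μ)                 ≡⟨ ∫-++ p q _ ⟩
    ∫ p (δ μ) ℤ.+ ∫ q (δ μ)         ≡⟨ cong₂ ℤ._+_ (from h μ) (from k μ) ⟩
    ∫ p′ (δ μ) ℤ.+ ∫ q′ (δ μ)       ≡⟨ ∫-++ p′ q′ _ ⟨
    ∫ (p′ + q′) (δ μ)               ≡⟨ coeff-∫ (p′ + q′) μ ⟨
    coeff (p′ + q′) μ               ∎
    where open ≡-Reasoning

  +-comm : ∀ p q → p + q ≈ q + p
  +-comm p q = to λ f →
    trans (∫-++ p q f) (trans (ℤ.+-comm (∫ p f) (∫ q f)) (sym (∫-++ q p f)))

  -‿cong : p ≈ q → - p ≈ - q
  -‿cong {p} {q} h = mk≈ λ μ → begin
    coeff (- p) μ    ≡⟨ coeff-∫ (- p) μ ⟩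
    ∫ (- p) (δ μ)    ≡⟨ ∫-neg p _ ⟩
    ℤ.- ∫ p (δ μ)    ≡⟨ cong (ℤ.-_) (from h μ) ⟩
    ℤ.- ∫ q (δ μ)    ≡⟨ ∫-neg q _ ⟨
    ∫ (- q) (δ μ)    ≡⟨ coeff-∫ (- q) μ ⟨
    coeff (- q) μ    ∎
    where open ≡-Reasoning

  -‿inverseʳ : ∀ p → p + - p ≈ 0#
  -‿inverseʳ p = to λ f →
    trans (∫-++ p (- p) f)
          (trans (cong (ℤ._+_ (∫ p f)) (∫-neg p f)) (ℤ.+-inverseʳ (∫ p f)))

  *-comm : ∀ p q → p * q ≈ q * p
  *-comm p q = to λ f → begin
    ∫ (p * q) f                            ≡⟨ ∫-* p q f ⟩
    ∫ p (λ μ → ∫ q (λ ν → f (μ ·ᵐ ν)))     ≡⟨ ∫-swap p q _ ⟩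
    ∫ q (λ ν → ∫ p (λ μ → f (μ ·ᵐ ν)))     ≡⟨ ∫-cong q (λ ν → ∫-cong p (λ μ → cong f (·ᵐ-comm μ ν))) ⟩
    ∫ q (λ ν → ∫ p (λ μ → f (ν ·ᵐ μ)))     ≡⟨ ∫-* q p f ⟨
    ∫ (q * p) f                            ∎
    where open ≡-Reasoning

  *-congˡ : ∀ p → q ≈ q′ → p * q ≈ p * q′
  *-congˡ {q} {q′} p h = mk≈ λ μ → begin
    coeff (p * q) μ                           ≡⟨ coeff-∫ (p * q) μ ⟩
    ∫ (p * q) (δ μ)                           ≡⟨ ∫-* p q _ ⟩
    ∫ p (λ ν → ∫ q (λ ρ → δ μ (ν ·ᵐ ρ)))      ≡⟨ ∫-cong p (λ ν → ∫-shift h ν μ) ⟩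
    ∫ p (λ ν → ∫ q′ (λ ρ → δ μ (ν ·ᵐ ρ)))     ≡⟨ ∫-* p q′ _ ⟨
    ∫ (p * q′) (δ μ)                          ≡⟨ coeff-∫ (p * q′) μ ⟨
    coeff (p * q′) μ                          ∎
    where open ≡-Reasoning

  *-cong : p ≈ p′ → q ≈ q′ → p * q ≈ p′ * q′
  *-cong {p} {p′} {q} {q′} h k =
    ≈-trans (*-congˡ p k)
      (≈-trans (*-comm p q′) (≈-trans (*-congˡ q′ h) (*-comm q′ p′)))

  *-assoc : ∀ p q r → (p * q) * r ≈ p * (q * r)
  *-assoc p q r = to λ f → begin
    ∫ ((p * q) * r) f
      ≡⟨ ∫-* (p * q) r f ⟩
    ∫ (p * q) (λ μ → ∫ r (λ ρ → f (μ ·ᵐ ρ)))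
      ≡⟨ ∫-* p q _ ⟩
    ∫ p (λ μ → ∫ q (λ ν → ∫ r (λ ρ → f ((μ ·ᵐ ν) ·ᵐ ρ))))
      ≡⟨ ∫-cong p (λ μ → ∫-cong q λ ν → ∫-cong r λ ρ → cong f (·ᵐ-assoc μ ν ρ)) ⟩
    ∫ p (λ μ → ∫ q (λ ν → ∫ r (λ ρ → f (μ ·ᵐ ν ·ᵐ ρ))))
      ≡⟨ ∫-cong p (λ μ → ∫-* q r _) ⟨
    ∫ p (λ μ → ∫ (q * r) (λ ν → f (μ ·ᵐ ν)))
      ≡⟨ ∫-* p (q * r) f ⟨
    ∫ (p * (q * r)) f ∎
    where open ≡-Reasoning

  *-identityˡ : ∀ p → 1# * p ≈ p
  *-identityˡ p = to λ f → begin
    ∫ (1# * p) f                                ≡⟨ ∫-* 1# p f ⟩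
    1ℤ ℤ.* ∫ p (λ μ → f (1ᵐ ·ᵐ μ)) ℤ.+ 0ℤ       ≡⟨ ℤ.+-identityʳ _ ⟩
    1ℤ ℤ.* ∫ p (λ μ → f (1ᵐ ·ᵐ μ))              ≡⟨ ℤ.*-identityˡ _ ⟩
    ∫ p (λ μ → f (1ᵐ ·ᵐ μ))                     ≡⟨ ∫-cong p (cong f ∘ ·ᵐ-identityˡ) ⟩
    ∫ p f                                       ∎
    where open ≡-Reasoning

  *-distribʳ-+ : ∀ p q r → (q + r) * p ≈ q * p + r * p
  *-distribʳ-+ p q r = to λ f → begin
    ∫ ((q + r) * p) f               ≡⟨ ∫-* (q + r) p f ⟩
    ∫ (q + r) _                     ≡⟨ ∫-++ q r _ ⟩
    ∫ q _ ℤ.+ ∫ r _                 ≡⟨ cong₂ ℤ._+_ (∫-* q p f) (∫-* r p f) ⟨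
    ∫ (q * p) f ℤ.+ ∫ (r * p) f     ≡⟨ ∫-++ (q * p) (r * p) f ⟨
    ∫ (q * p + r * p) f             ∎
    where open ≡-Reasoning

  commutativeRing : CommutativeRing 0ℓ 0ℓ
  commutativeRing = record
    { Carrier = Polynomial n
    ; _≈_ = _≈_ ; _+_ = _+_ ; _*_ = _*_ ; -_ = -_ ; 0# = 0# ; 1# = 1#
    ; isCommutativeRing = record
      { isRing = record
        { +-isAbelianGroup = record
          { isGroup = record
            { isMonoid = record
              { isSemigroup = record
                { isMagma = record
                  { isEquivalence = record { refl = ≈-refl ; sym = ≈-sym ; trans = ≈-trans }
                  ; ∙-cong = +-cong
                  }
                ; assoc = λ p q r → ≡⇒≈ (List.++-assoc p q r)
                }
              ; identity = (λ _ → ≈-refl) , λ p → ≡⇒≈ (List.++-identityʳ p)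
              }
            ; inverse =
                (λ p → ≈-trans (+-comm (- p) p) (-‿inverseʳ p)) , -‿inverseʳ
            ; ⁻¹-cong = -‿cong
            }
          ; comm = +-comm
          }
        ; *-cong = *-cong
        ; *-assoc = *-assoc
        ; *-identity =
            *-identityˡ , λ p → ≈-trans (*-comm p 1#) (*-identityˡ p)
        ; distrib =
            (λ p q r → ≈-trans (*-comm p (q + r))
              (≈-trans (*-distribʳ-+ p q r) (+-cong (*-comm q p) (*-comm r p))))
            , *-distribʳ-+
        }
      ; *-comm = *-comm
      }
    }

polynomialRing : ℕ → CommutativeRing 0ℓ 0ℓ
polynomialRing n = PolynomialRing.commutativeRing {n}

infixr 8 _^_
_^_ : ∀ {n} → Polynomial n → ℕ → Polynomial n
_^_ {n} = Exp._^_ (CommutativeRing.semiring (polynomialRing n))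

-- (-1)ᶻ depends only on the parity of z, hence only on ∣ z ∣.
[-1]^_ : ∀ {n} → ℤ → Polynomial n
[-1]^ z = (- 1#) ^ ℤ.∣ z ∣

sumOver prodOver : ∀ {n} {A : Set} → List A → (A → Polynomial n) → Polynomial n
sumOver  xs f = foldr _+_ 0# (map f xs)
prodOver xs f = foldr _*_ 1# (map f xs)

infix 5 sumOver prodOver
syntax sumOver  xs (λ x → e) = ∑[ x ← xs ] e
syntax prodOver xs (λ x → e) = ∏[ x ← xs ] e

module _ {A : Set} (_≟_ : Decidable₂ {A = A} _≡_) (L : List (A × A)) where

  private
    E : Rel A 0ℓ
    E x y = (x , y) Mem.∈ L

  star-∈? : Decidable₂ (Star E)
  star-∈? = go L
    where
    go : ∀ L → Decidable₂ (Star (λ x y → (x , y) Mem.∈ L))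
    go []            x y with x ≟ y
    ... | yes refl = yes ε
    ... | no  x≢y  = no λ where ε → x≢y refl
    go ((a , b) ∷ L) x y =
      map′ to from (go L x y ⊎-dec (go L x a ×-dec go L b y))
      where
      to : Star _ x y ⊎ (Star _ x a × Star _ b y) → Star _ x y
      to (inj₁ xy)        = Star.map there xy
      to (inj₂ (xa , by)) = Star.map there xa ◅◅ here refl ◅ Star.map there by

      from : ∀ {x y} → Star (λ x y → (x , y) Mem.∈ (a , b) ∷ L) x y →
             Star (λ x y → (x , y) Mem.∈ L) x y ⊎
             (Star (λ x y → (x , y) Mem.∈ L) x a × Star (λ x y → (x , y) Mem.∈ L) b y)
      from ε = inj₁ ε
      from (here refl ◅ s) with from s
      ... | inj₁ by       = inj₂ (ε , by)
      ... | inj₂ (_ , by) = inj₂ (ε , by)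
      from (there e ◅ s) with from s
      ... | inj₁ zy        = inj₁ (e ◅ zy)
      ... | inj₂ (za , by) = inj₂ (e ◅ za , by)

star? : ∀ {n} {R : Rel (Fin n) 0ℓ} → Decidable₂ R → Decidable₂ (Star R)
star? {n} {R} R? x y = map′ (Star.map to) (Star.map from) (star-∈? Fin._≟_ L x y)
  where
  pairs L : List (Fin n × Fin n)
  pairs = cartesianProduct (allFin n) (allFin n)
  L = filter (λ (u , v) → R? u v) pairs

  to : ∀ {u v} → (u , v) Mem.∈ L → R u v
  to = proj₂ ∘ ∈-filter⁻ (λ (u , v) → R? u v) {xs = pairs}

  from : ∀ {u v} → R u v → (u , v) Mem.∈ L
  from {u} {v} r =
    ∈-filter⁺ (λ (u , v) → R? u v) (∈-cartesianProduct⁺ (∈-allFin u) (∈-allFin v)) r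

-- A directed cycle v → v₁ → … → vₖ → v through distinct vertices v, v₁, …, vₖ;
-- k = 0 is a loop and k = 1 a pair of opposite arcs.
Cycle : ∀ {n} → Rel (Fin n) 0ℓ → Set
Cycle R = ∃₂ λ v vs → Unique (v ∷ vs) × Linked R (v ∷ vs ∷ʳ v)

ClosedWalk : ∀ {n} → Rel (Fin n) 0ℓ → Set
ClosedWalk R = ∃₂ λ u v → R u v × Star R v u

module _ {n} {R : Rel (Fin n) 0ℓ} where

  open import Data.List.Membership.DecPropositional (Fin._≟_ {n}) using () renaming (_∈?_ to _∈ˡ?_)

  private
    SimplePath : Rel (Fin n) 0ℓ
    SimplePath x y = ∃ λ ws → Unique (x ∷ ws) × (∀ z → R y z → Linked R (x ∷ ws ∷ʳ z))

    Linked-tail : ∀ {x xs} → Linked R (x ∷ xs) → Linked R xs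
    Linked-tail [-]     = []
    Linked-tail (_ ∷ l) = l

    suffix : ∀ {x y} z ws → x Mem.∈ z ∷ ws → Unique (z ∷ ws) →
             (∀ t → R y t → Linked R (z ∷ ws ∷ʳ t)) → SimplePath x y
    suffix z ws       (here refl) u       l = ws , u , l
    suffix z (w ∷ ws) (there x∈)  (_ ∷ u) l = suffix w ws x∈ u λ t r → Linked-tail (l t r)

    simplify : ∀ {x y} → Star R x y → SimplePath x y
    simplify ε = [] , [] ∷ [] , λ _ r → r ∷ [-]
    simplify {x} (_◅_ {j = z} r s) with simplify s
    ... | ws , u , l with x ∈ˡ? (z ∷ ws)
    ...   | yes x∈ = suffix z ws x∈ u l
    ...   | no  x∉ = z ∷ ws , All.¬Any⇒All¬ _ x∉ ∷ u , λ t r′ → r ∷ l t r′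

    walk : ∀ x ws z → Linked R (x ∷ ws ∷ʳ z) → ∃ λ y → R x y × Star R y z
    walk x []       z (r ∷ _) = z , r , ε
    walk x (w ∷ ws) z (r ∷ l) = let _ , r′ , s = walk w ws z l in w , r , r′ ◅ s

  closedWalk⇒cycle : ClosedWalk R → Cycle R
  closedWalk⇒cycle (u , v , r , s) = let ws , uniq , l = simplify s in v , ws , uniq , l v r

  cycle⇒closedWalk : Cycle R → ClosedWalk R
  cycle⇒closedWalk (v , vs , _ , l) = v , walk v vs v l

  cycle? : Decidable₂ R → Dec (Cycle R)
  cycle? R? = map′ closedWalk⇒cycle cycle⇒closedWalk
    (Fin.any? λ u → Fin.any? λ v → R? u v ×-dec star? R? v u)

-- Multiple edges and loops are allowed.  The order of the two ends of an
-- edge carries no meaning beyond serving as a reference direction.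
record Graph : Set where
  field
    d    : ℕ
    m    : ℕ
    ends : Fin m → Fin d × Fin d

-- All subsets of Fin n, i.e. all boolean vectors of length n, once each.
subsets : ∀ n → List (Subset n)
subsets zero    = [] ∷ []
subsets (suc n) = map (false ∷_) (subsets n) ++ map (true ∷_) (subsets n)

elements : ∀ {n} → Subset n → List (Fin n)
elements {n} C = filter (_∈? C) (allFin n)

module _ (G : Graph) where
  open Graph G

  Vertex Edge : Set
  Vertex = Fin d
  Edge   = Fin m

  ℤ[V] : Set
  ℤ[V] = Polynomial d

  Incident : Vertex → Edge → Set
  Incident v e = v ≡ proj₁ (ends e) ⊎ v ≡ proj₂ (ends e)

  -- An edge with ends (a , b) is directed a → b if its entry is true
  -- and b → a if it is false.
  Orientation : Set
  Orientation = Vec Bool m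

  orientations : List Orientation
  orientations = subsets m

  tail head : Orientation → Edge → Vertex
  tail o e = if lookup o e then proj₁ (ends e) else proj₂ (ends e)
  head o e = if lookup o e then proj₂ (ends e) else proj₁ (ends e)

  Arc : Orientation → Rel Vertex 0ℓ
  Arc o u v = ∃ λ e → tail o e ≡ u × head o e ≡ v

  Acyclic : Orientation → Set
  Acyclic o = ¬ Cycle (Arc o)

  IsSink : Orientation → Vertex → Set
  IsSink o v = ∀ e → Incident v e → head o e ≡ v

  acyclic? : Decidable₁ Acyclic
  acyclic? o = ¬? (cycle? λ u v →
    Fin.any? λ e → (tail o e Fin.≟ u) ×-dec (head o e Fin.≟ v))

  isSink? : ∀ o → Decidable₁ (IsSink o)
  isSink? o v = Fin.all? λ e →
    ((v Fin.≟ proj₁ (ends e)) ⊎-dec (v Fin.≟ proj₂ (ends e))) →-dec (head o e Fin.≟ v)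

  𝒜 : List Orientation
  𝒜 = filter acyclic? orientations

  Sink : Orientation → List Vertex
  Sink o = filter (isSink? o) (allFin d)

  sink : Orientation → ℕ
  sink o = length (Sink o)

  A[V] : ℤ[V]
  A[V] = ∑[ o ← 𝒜 ] ∏[ v ← Sink o ] var v

  Adjacent : Subset m → Rel Vertex 0ℓ
  Adjacent S u v = ∃ λ e → e ∈ S × ends e ≡ (u , v)

  Connected : Subset m → Rel Vertex 0ℓ
  Connected S = EqClosure (Adjacent S)

  -- Components are given by their vertex sets.
  IsComponent : Subset m → Subset d → Set
  IsComponent S C = ∃ λ v → ∀ w → w ∈ C ⇔ Connected S v w

  adjacent? : ∀ S → Decidable₂ (Adjacent S)
  adjacent? S u v = Fin.any? λ e → (e ∈? S) ×-dec ≡-dec Fin._≟_ Fin._≟_ (ends e) (u , v)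

  connected? : ∀ S → Decidable₂ (Connected S)
  connected? S = star? λ u v →
    map′ (λ { (inj₁ a) → fwd a ; (inj₂ a) → bwd a })
         (λ { (fwd a) → inj₁ a ; (bwd a) → inj₂ a })
         (adjacent? S u v ⊎-dec adjacent? S v u)

  isComponent? : ∀ S → Decidable₁ (IsComponent S)
  isComponent? S C = Fin.any? λ v → Fin.all? λ w →
    map′ (λ (f , g) → mk⇔ f g) (λ e → Equivalence.to e , Equivalence.from e)
      (((w ∈? C) →-dec connected? S v w) ×-dec (connected? S v w →-dec (w ∈? C)))

  𝒞 : Subset m → List (Subset d)
  𝒞 S = filter (isComponent? S) (subsets d)

  corank : Subset m → ℤ
  corank S = + size S ℤ.- + d ℤ.+ + length (𝒞 S)

  -- v_C for the component with vertex set C.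
  vᶜ : Subset d → ℤ[V]
  vᶜ C = 1# - (∏[ v ← elements C ] (1# - var v))

ℤ[t] : Set
ℤ[t] = Polynomial 1

t : ℤ[t]
t = var zero

a[t] : Graph → ℤ[t]
a[t] G = ∑[ o ← 𝒜 G ] t ^ sink G o

{-# OPTIONS --safe #-}

-- Both sides satisfy the same deletion–contraction rule in an edge e = ab,
-- provided every vertex v carries a weight 1 - y v and contraction multiplies
-- the y's: y a is replaced by y a * y b.  The vertex set is kept fixed under
-- contraction: all edges at b are moved to a, and b stays as an isolated vertex
-- with y b = 0, hence of weight 1.  The orientation side splits according to
-- which of the two directions of e close a cycle; on the subgraph side the
-- subsets without e are those of the deletion and the subsets with e those of
-- the contraction.
module Submission where

open import Algebra.Bundles using (CommutativeMonoid; CommutativeRing)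
import Algebra.Properties.CommutativeSemigroup as CommutativeSemigroupProperties
import Algebra.Properties.Ring as RingProperties
import Algebra.Properties.Semiring.Exp as Exp
open import Data.Bool.Base using (Bool; true; false; if_then_else_; _xor_)
import Data.Bool.Properties as Bool
open import Data.Fin.Base using (Fin; zero; suc)
import Data.Fin.Properties as Fin
open import Data.Fin.Subset using (Subset; ⁅_⁆; ∣_∣) renaming (_∈_ to _∈ˢ_)
import Data.Fin.Subset.Properties as Subset
open import Data.Fin.Subset.Properties using (_∈?_)
import Data.Integer.Base as ℤ
open ℤ using (ℤ; +_; -[1+_])
open import Data.Integer.Tactic.RingSolver using (solve-∀)
open import Data.List.Base as List
  using (List; []; _∷_; _++_; map; foldr; filter; length; allFin)
import Data.List.Properties as List
open import Data.List.Membership.Propositional using (_∈_)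
open import Data.List.Membership.Propositional.Properties
  using (∈-allFin; ∈-filter⁺; ∈-filter⁻; ∈-map⁺; ∈-map⁻; ∈-++⁺ˡ; ∈-++⁺ʳ)
open import Data.List.Membership.Propositional.Properties.WithK using (unique∧set⇒bag)
open import Data.List.Relation.Binary.BagAndSetEquality using (∼bag⇒↭)
open import Data.List.Relation.Binary.Permutation.Propositional as Perm using (_↭_)
open import Data.List.Relation.Binary.Permutation.Propositional.Properties using (↭-length)
open import Data.List.Relation.Unary.All as All using ([]; _∷_)
open import Data.List.Relation.Unary.AllPairs using ([]; _∷_)
open import Data.List.Relation.Unary.Any using (here; there)
open import Data.List.Relation.Unary.Unique.Propositional using (Unique)
import Data.List.Relation.Unary.Unique.Propositional.Properties as Unique
open import Data.Nat.Base using (ℕ; zero; suc)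
open import Data.Product.Base using (∃; ∃₂; _×_; _,_; proj₁; proj₂)
open import Data.Sum.Base as Sum using (_⊎_; inj₁; inj₂; [_,_])
open import Data.Vec.Base as Vec using (Vec; []; _∷_; lookup; _[_]≔_)
import Data.Vec.Properties as Vec
open import Defs
  using (Graph; Incident; tail; head; Arc; Cycle; ClosedWalk; Acyclic; IsSink;
         acyclic?; isSink?; cycle?; star?; closedWalk⇒cycle; cycle⇒closedWalk; 𝒜; Sink;
         subsets; elements; Adjacent; Connected; IsComponent; isComponent?; 𝒞; corank)
open import Function.Base using (_∘_; const; id)
open import Function.Bundles using (_⇔_; mk⇔; Equivalence)
open import Level using (0ℓ)
open import Relation.Binary.Construct.Closure.Equivalence as EqClosure using ()
open import Relation.Binary.Construct.Closure.ReflexiveTransitive as Star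
  using (Star; ε; _◅_; _◅◅_)
open import Relation.Binary.Construct.Closure.Symmetric using (fwd; bwd)
open import Relation.Binary.Core using (Rel; _⇒_)
open import Relation.Binary.PropositionalEquality
  using (_≡_; _≢_; refl; sym; trans; cong; cong₂; subst; module ≡-Reasoning)
open import Relation.Nullary.Decidable
  using (Dec; yes; no; does; dec-true; dec-false; does-⇔; _×-dec_)
open import Relation.Nullary.Negation using (¬_; contradiction)
open import Relation.Unary using (Pred; Decidable)

-- The weights are written 1 - y because v_C = 1 - ∏ (1 - v): in terms of y = 1 - v a component has
-- weight 1 - ∏ y, and merging vertices just multiplies their y's. After a contraction the weights
-- are no longer distinct variables, so the induction on the number of edges has to allow arbitrary
-- values y. Taking them in any commutative ring yields both formulas directly: y v = 1 - v in ℤ[V],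
-- and y constantly 1 - t in ℤ[t]. The value y b = 0 makes the leftover vertex b invisible: it is a
-- sink of every orientation of the contraction and a component of every edge subset, each time with
-- factor 1 - 0 = 1. This extra component also makes up for the lost edge in |S| - d + |C(S)|, with
-- d unchanged, so coranks agree. The rule is proved for each orientation of the deletion
-- separately; where neither direction closes a cycle it comes down to (1 - x) + (1 - y) = (1 - x)(1
-- - y) + (1 - xy). A loop is not contracted: there both sides are 0.

-- Finite sums and products in a commutative monoid.

module Fold {c ℓ} (M : CommutativeMonoid c ℓ) where
  open CommutativeMonoid M renaming (ε to 𝟙; refl to ≈-refl; sym to ≈-sym; trans to ≈-trans)
  open import Relation.Binary.Reasoning.Setoid setoid
  open CommutativeSemigroupProperties commutativeSemigroup
    using (x∙yz≈y∙xz; interchange)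

  fold : {A : Set} → List A → (A → Carrier) → Carrier
  fold xs f = foldr _∙_ 𝟙 (map f xs)

  fold-cong-∈ : {A : Set} (xs : List A) {f g : A → Carrier} →
                (∀ {x} → x ∈ xs → f x ≈ g x) → fold xs f ≈ fold xs g
  fold-cong-∈ []       f≈g = ≈-refl
  fold-cong-∈ (x ∷ xs) f≈g = ∙-cong (f≈g (here refl)) (fold-cong-∈ xs (f≈g ∘ there))

  fold-cong : {A : Set} (xs : List A) {f g : A → Carrier} →
              (∀ x → f x ≈ g x) → fold xs f ≈ fold xs g
  fold-cong xs f≈g = fold-cong-∈ xs λ {x} _ → f≈g x

  fold-𝟙 : {A : Set} (xs : List A) {f : A → Carrier} → (∀ x → f x ≈ 𝟙) → fold xs f ≈ 𝟙
  fold-𝟙 []       f≈𝟙 = ≈-refl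
  fold-𝟙 (x ∷ xs) f≈𝟙 = ≈-trans (∙-cong (f≈𝟙 x) (fold-𝟙 xs f≈𝟙)) (identityˡ 𝟙)

  fold-∙ : {A : Set} (xs : List A) (f g : A → Carrier) →
           fold xs (λ x → f x ∙ g x) ≈ fold xs f ∙ fold xs g
  fold-∙ []       f g = ≈-sym (identityˡ 𝟙)
  fold-∙ (x ∷ xs) f g = ≈-trans (∙-congˡ (fold-∙ xs f g)) (interchange (f x) (g x) _ _)

  fold-++ : {A : Set} (xs ys : List A) (f : A → Carrier) →
            fold (xs ++ ys) f ≈ fold xs f ∙ fold ys f
  fold-++ []       ys f = ≈-sym (identityˡ _)
  fold-++ (x ∷ xs) ys f = ≈-trans (∙-congˡ (fold-++ xs ys f)) (≈-sym (assoc (f x) _ _))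

  fold-map : {A B : Set} (h : A → B) (xs : List A) (f : B → Carrier) →
             fold (map h xs) f ≡ fold xs (f ∘ h)
  fold-map h xs f = cong (foldr _∙_ 𝟙) (sym (List.map-∘ xs))

  fold-↭ : {A : Set} {xs ys : List A} (f : A → Carrier) → xs ↭ ys → fold xs f ≈ fold ys f
  fold-↭ f Perm.refl         = ≈-refl
  fold-↭ f (Perm.prep x p)   = ∙-congˡ (fold-↭ f p)
  fold-↭ f (Perm.swap x y p) = ≈-trans (∙-congˡ (∙-congˡ (fold-↭ f p))) (x∙yz≈y∙xz (f x) (f y) _)
  fold-↭ f (Perm.trans p q)  = ≈-trans (fold-↭ f p) (fold-↭ f q)

  fold-filter : {A : Set} {P : Pred A 0ℓ} (P? : Decidable P) (xs : List A) (f : A → Carrier) →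
                fold (filter P? xs) f ≈ fold xs (λ x → if does (P? x) then f x else 𝟙)
  fold-filter P? []       f = ≈-refl
  fold-filter P? (x ∷ xs) f with does (P? x)
  ... | true  = ∙-congˡ (fold-filter P? xs f)
  ... | false = ≈-trans (fold-filter P? xs f) (≈-sym (identityˡ _))

  fold-subsets : ∀ n (f : Subset (suc n) → Carrier) →
                 fold (subsets (suc n)) f ≈
                 fold (subsets n) (λ S → f (false ∷ S) ∙ f (true ∷ S))
  fold-subsets n f = begin
    fold (map (false ∷_) (subsets n) ++ map (true ∷_) (subsets n)) f
      ≈⟨ fold-++ (map (false ∷_) (subsets n)) _ f ⟩
    fold (map (false ∷_) (subsets n)) f ∙ fold (map (true ∷_) (subsets n)) f
      ≡⟨ cong₂ _∙_ (fold-map (false ∷_) (subsets n) f) (fold-map (true ∷_) (subsets n) f) ⟩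
    fold (subsets n) (λ S → f (false ∷ S)) ∙ fold (subsets n) (λ S → f (true ∷ S))
      ≈⟨ fold-∙ (subsets n) _ _ ⟨
    fold (subsets n) (λ S → f (false ∷ S) ∙ f (true ∷ S)) ∎

  module _ {n : ℕ} where

    -- Overwriting the value at `a` by the unit, instead of deleting `a` from the list, keeps every
    -- product over all of `Fin n`; the remaining products for different graphs can then be compared
    -- vertex by vertex.
    _except_ : (Fin n → Carrier) → Fin n → Fin n → Carrier
    (f except a) v = if does (v Fin.≟ a) then 𝟙 else f v

    except-≢ : ∀ f {a v} → v ≢ a → (f except a) v ≡ f v
    except-≢ f {a} {v} v≢a rewrite dec-false (v Fin.≟ a) v≢a = refl

    except-≡ : ∀ f a → (f except a) a ≡ 𝟙
    except-≡ f a rewrite dec-true (a Fin.≟ a) refl = refl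

    -- `Unique` matters because `except` blanks out all occurrences of `a`, while only one of them
    -- is pulled to the front.
    fold-extract : (xs : List (Fin n)) (f : Fin n → Carrier) {a : Fin n} → Unique xs → a ∈ xs →
                   fold xs f ≈ f a ∙ fold xs (f except a)
    fold-extract (a ∷ xs) f (a∉ ∷ _) (here refl) = ∙-congˡ (begin
      fold xs f
        ≈⟨ fold-cong-∈ xs (λ v∈ → reflexive (sym (except-≢ f λ { refl → All.lookup a∉ v∈ refl }))) ⟩
      fold xs (f except a)
        ≈⟨ identityˡ _ ⟨
      𝟙 ∙ fold xs (f except a)
        ≈⟨ ∙-congʳ (reflexive (except-≡ f a)) ⟨
      (f except a) a ∙ fold xs (f except a) ∎)
    fold-extract (x ∷ xs) f {a} (x∉ ∷ u) (there a∈) = begin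
      f x ∙ fold xs f                               ≈⟨ ∙-congˡ (fold-extract xs f u a∈) ⟩
      f x ∙ (f a ∙ fold xs (f except a))            ≈⟨ x∙yz≈y∙xz _ _ _ ⟩
      f a ∙ (f x ∙ fold xs (f except a))            ≈⟨ ∙-congˡ (∙-congʳ (reflexive (except-≢ f (All.lookup x∉ a∈)))) ⟨
      f a ∙ ((f except a) x ∙ fold xs (f except a)) ∎

    fold-extract₂ : (f : Fin n → Carrier) {a b : Fin n} → a ≢ b →
                    fold (allFin n) f ≈ f a ∙ (f b ∙ fold (allFin n) ((f except a) except b))
    fold-extract₂ f {a} {b} a≢b = begin
      fold (allFin n) f
        ≈⟨ fold-extract _ f (Unique.allFin⁺ n) (∈-allFin a) ⟩
      f a ∙ fold (allFin n) (f except a)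
        ≈⟨ ∙-congˡ (fold-extract _ (f except a) (Unique.allFin⁺ n) (∈-allFin b)) ⟩
      f a ∙ ((f except a) b ∙ fold (allFin n) ((f except a) except b))
        ≈⟨ ∙-congˡ (∙-congʳ (reflexive (except-≢ f (a≢b ∘ sym)))) ⟩
      f a ∙ (f b ∙ fold (allFin n) ((f except a) except b)) ∎

    fold-except-cong : {f g : Fin n → Carrier} (a b : Fin n) →
                       (∀ v → v ≢ a → v ≢ b → f v ≈ g v) →
                       fold (allFin n) ((f except a) except b) ≈
                       fold (allFin n) ((g except a) except b)
    fold-except-cong {f} {g} a b f≈g = fold-cong (allFin n) same
      where
      same : ∀ v → ((f except a) except b) v ≈ ((g except a) except b) v
      same v with v Fin.≟ b
      ... | yes _ = ≈-refl
      ... | no v≢b with v Fin.≟ a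
      ...   | yes _ = ≈-refl
      ...   | no v≢a = f≈g v v≢a v≢b

-- Closed walks after adding an arc or identifying two vertices.

module _ {n : ℕ} where

  NoOut : Rel (Fin n) 0ℓ → Fin n → Set
  NoOut R v = ∀ w → ¬ R v w

  closedWalk-map : {R R′ : Rel (Fin n) 0ℓ} → R ⇒ R′ → ClosedWalk R → ClosedWalk R′
  closedWalk-map f (u , v , r , s) = u , v , f r , Star.map f s

  acyclic⇒antisym : {R : Rel (Fin n) 0ℓ} → ¬ ClosedWalk R → ∀ {u v} → u ≢ v → Star R u v → ¬ Star R v u
  acyclic⇒antisym acyc u≢v ε       t = u≢v refl
  acyclic⇒antisym acyc u≢v (r ◅ s) t = acyc (_ , _ , r , s ◅◅ t)

  Adjoin : Rel (Fin n) 0ℓ → Fin n → Fin n → Rel (Fin n) 0ℓ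
  Adjoin R a b u v = R u v ⊎ (u ≡ a × v ≡ b)

  module _ {R : Rel (Fin n) 0ℓ} {a b : Fin n} where

    -- The new arc may be used many times; only the part before its first use and the part after its
    -- last use are kept.
    star-adjoin : ∀ {u v} → Star (Adjoin R a b) u v → Star R u v ⊎ (Star R u a × Star R b v)
    star-adjoin ε = inj₁ ε
    star-adjoin (inj₁ r ◅ s) with star-adjoin s
    ... | inj₁ wv        = inj₁ (r ◅ wv)
    ... | inj₂ (wa , bv) = inj₂ (r ◅ wa , bv)
    star-adjoin (inj₂ (refl , refl) ◅ s) with star-adjoin s
    ... | inj₁ bv       = inj₂ (ε , bv)
    ... | inj₂ (_ , bv) = inj₂ (ε , bv)

    closedWalk-adjoin⁻ : ClosedWalk (Adjoin R a b) → ClosedWalk R ⊎ Star R b a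
    closedWalk-adjoin⁻ (u , v , inj₁ r , s) with star-adjoin s
    ... | inj₁ vu        = inj₁ (u , v , r , vu)
    -- The closed walk is cut open at the new arc: from `b` on to `u`, along `r`, then on to `a`.
    ... | inj₂ (va , bu) = inj₂ (bu ◅◅ r ◅ va)
    closedWalk-adjoin⁻ (_ , _ , inj₂ (refl , refl) , s) with star-adjoin s
    ... | inj₁ ba       = inj₂ ba
    ... | inj₂ (ba , _) = inj₂ ba

    closedWalk-adjoin⁺ : Star R b a → ClosedWalk (Adjoin R a b)
    closedWalk-adjoin⁺ s = a , b , inj₂ (refl , refl) , Star.map inj₁ s

module Identify {n : ℕ} {a b : Fin n} (a≢b : a ≢ b) where

  φ : Fin n → Fin n
  φ v = if does (v Fin.≟ b) then a else v

  φ-b : φ b ≡ a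
  φ-b rewrite dec-true (b Fin.≟ b) refl = refl

  φ-≢ : ∀ {v} → v ≢ b → φ v ≡ v
  φ-≢ {v} v≢b rewrite dec-false (v Fin.≟ b) v≢b = refl

  φ-a : φ a ≡ a
  φ-a = φ-≢ a≢b

  φ≢b : ∀ {v} → φ v ≢ b
  φ≢b {v} with v Fin.≟ b
  ... | yes _  = a≢b
  ... | no v≢b = v≢b

  φ⁻¹ : ∀ {u v} → v ≢ a → φ u ≡ v → u ≡ v
  φ⁻¹ {u} v≢a eq with u Fin.≟ b
  ... | yes _ = contradiction (sym eq) v≢a
  ... | no _  = eq

  Ends : Fin n → Set
  Ends v = v ≡ a ⊎ v ≡ b

  φ-a⁻¹ : ∀ {u} → φ u ≡ a → Ends u
  φ-a⁻¹ {u} eq with u Fin.≟ b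
  ... | yes u≡b = inj₂ u≡b
  ... | no _    = inj₁ eq

  φ-ends : ∀ {v} → Ends v → φ v ≡ a
  φ-ends (inj₁ refl) = φ-a
  φ-ends (inj₂ refl) = φ-b

  φ-fibre : ∀ {u v} → φ u ≡ φ v → u ≡ v ⊎ (Ends u × Ends v)
  φ-fibre {u} {v} eq = case (v Fin.≟ a) (v Fin.≟ b)
    where
    case : Dec (v ≡ a) → Dec (v ≡ b) → u ≡ v ⊎ (Ends u × Ends v)
    case (yes v≡a) _         = let v-end = inj₁ v≡a in inj₂ (φ-a⁻¹ (trans eq (φ-ends v-end)) , v-end)
    case (no _)    (yes v≡b) = let v-end = inj₂ v≡b in inj₂ (φ-a⁻¹ (trans eq (φ-ends v-end)) , v-end)
    case (no v≢a)  (no v≢b)  = inj₁ (φ⁻¹ v≢a (trans eq (φ-≢ v≢b)))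

  Image : Rel (Fin n) 0ℓ → Rel (Fin n) 0ℓ
  Image R x y = ∃₂ λ u v → R u v × φ u ≡ x × φ v ≡ y

  module _ {R : Rel (Fin n) 0ℓ} where

    image : ∀ {u v} → R u v → Image R (φ u) (φ v)
    image r = _ , _ , r , refl , refl

    -- The lift is cut wherever the walk passes through the merged vertex, since consecutive arcs
    -- may meet there at different ends. Kept are the part up to the first cut, at `c`, and the part
    -- after the last, from `c′`.
    star-image⁻ : ∀ {x y} → Star (Image R) x y → ∀ {u v} → φ u ≡ x → φ v ≡ y →
                  Star R u v ⊎ ∃₂ λ c c′ → Ends c × Ends c′ × Star R u c × Star R c′ v
    star-image⁻ ε {u} {v} φu≡x φv≡x with φ-fibre {u} {v} (trans φu≡x (sym φv≡x))
    ... | inj₁ refl      = inj₁ ε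
    ... | inj₂ (cu , cv) = inj₂ (_ , _ , cu , cv , ε , ε)
    star-image⁻ ((u′ , w , r , refl , refl) ◅ s) {u} {v} φu≡x φv≡y
      with φ-fibre {u} {u′} φu≡x | star-image⁻ s {w} {v} refl φv≡y
    ... | inj₁ refl       | inj₁ wv = inj₁ (r ◅ wv)
    ... | inj₁ refl       | inj₂ (c , c′ , ec , ec′ , wc , c′v) = inj₂ (c , c′ , ec , ec′ , r ◅ wc , c′v)
    ... | inj₂ (eu , eu′) | inj₁ wv = inj₂ (_ , _ , eu , eu′ , ε , r ◅ wv)
    ... | inj₂ (eu , _)   | inj₂ (_ , c′ , _ , ec′ , _ , c′v) = inj₂ (_ , c′ , eu , ec′ , ε , c′v)

    -- If the ends `c` and `c′` agree, the lift closes up; if not, rotating it so that `r` lies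
    -- inside gives a path from one end to the other.
    closedWalk-image⁻ : ClosedWalk (Image R) → ClosedWalk R ⊎ Star R a b ⊎ Star R b a
    closedWalk-image⁻ (_ , _ , (u , v , r , refl , refl) , s) with star-image⁻ s {v} {u} refl refl
    ... | inj₁ vu = inj₁ (u , v , r , vu)
    ... | inj₂ (c , c′ , ec , ec′ , vc , c′u) = close ec ec′ vc c′u
      where
      close : ∀ {c c′} → Ends c → Ends c′ → Star R v c → Star R c′ u →
              ClosedWalk R ⊎ Star R a b ⊎ Star R b a
      close (inj₁ refl) (inj₁ refl) vc cu = inj₁ (u , v , r , vc ◅◅ cu)
      close (inj₂ refl) (inj₂ refl) vc cu = inj₁ (u , v , r , vc ◅◅ cu)
      close (inj₁ refl) (inj₂ refl) va bu = inj₂ (inj₂ (bu ◅◅ r ◅ va))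
      close (inj₂ refl) (inj₁ refl) vb au = inj₂ (inj₁ (au ◅◅ r ◅ vb))

    closedWalk-image⁺ : ClosedWalk R → ClosedWalk (Image R)
    closedWalk-image⁺ (u , v , r , s) = φ u , φ v , image r , Star.gmap φ image s

    -- Distinct endpoints force at least one arc, and the image of a nonempty walk between
    -- identified vertices is closed.
    path⇒closedWalk-image : ∀ {u v} → u ≢ v → φ u ≡ φ v → Star R u v → ClosedWalk (Image R)
    path⇒closedWalk-image u≢v φu≡φv ε       = contradiction refl u≢v
    path⇒closedWalk-image {u} u≢v φu≡φv (_◅_ {j = w} r s) =
      φ u , φ w , image r , subst (Star _ (φ w)) (sym φu≡φv) (Star.gmap φ image s)

-- Sinks of acyclic orientations.

module _ (G : Graph) where
  open Graph G

  acyclic⁺ : ∀ o → ¬ ClosedWalk (Arc G o) → Acyclic G o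
  acyclic⁺ o ¬w c = ¬w (cycle⇒closedWalk c)

  acyclic⁻ : ∀ o → Acyclic G o → ¬ ClosedWalk (Arc G o)
  acyclic⁻ o ¬c w = ¬c (closedWalk⇒cycle w)

  incident-tail : ∀ o e → Incident G (tail G o e) e
  incident-tail o e with lookup o e
  ... | true  = inj₁ refl
  ... | false = inj₂ refl

  incident⁻ : ∀ o e {v} → Incident G v e → v ≡ tail G o e ⊎ v ≡ head G o e
  incident⁻ o e inc with lookup o e | inc
  ... | true  | inj₁ v≡ = inj₁ v≡
  ... | true  | inj₂ v≡ = inj₂ v≡
  ... | false | inj₁ v≡ = inj₂ v≡
  ... | false | inj₂ v≡ = inj₁ v≡

  -- The only arc that can leave a sink is a loop, whose head is again `v`, so that `IsSink`
  -- tolerates it; acyclicity is what excludes it.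
  sink⇒noOut : ∀ o {v} → Acyclic G o → IsSink G o v → NoOut (Arc G o) v
  sink⇒noOut o acyc sink _ (e , refl , refl) =
    acyclic⁻ o acyc (_ , _ , (e , refl , sink e (incident-tail o e)) , ε)

  noOut⇒sink : ∀ o {v} → NoOut (Arc G o) v → IsSink G o v
  noOut⇒sink o noOut e inc with incident⁻ o e inc
  ... | inj₁ refl = contradiction (e , refl , refl) (noOut _)
  ... | inj₂ v≡   = sym v≡

-- Orientations under deletion and contraction of the first edge.

module FirstEdge {d m : ℕ} (ends : Fin (suc m) → Fin d × Fin d) where

  a b : Fin d
  a = proj₁ (ends zero)
  b = proj₂ (ends zero)

  G G∖e : Graph
  G   = record { ends = ends }
  G∖e = record { ends = ends ∘ suc }

  arc-true⁻ : ∀ o → Arc G (true ∷ o) ⇒ Adjoin (Arc G∖e o) a b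
  arc-true⁻ o (zero  , refl , refl) = inj₂ (refl , refl)
  arc-true⁻ o (suc e , t , h)       = inj₁ (e , t , h)

  arc-true⁺ : ∀ o → Adjoin (Arc G∖e o) a b ⇒ Arc G (true ∷ o)
  arc-true⁺ o (inj₁ (e , t , h))    = suc e , t , h
  arc-true⁺ o (inj₂ (refl , refl)) = zero , refl , refl

  arc-false⁻ : ∀ o → Arc G (false ∷ o) ⇒ Adjoin (Arc G∖e o) b a
  arc-false⁻ o (zero  , refl , refl) = inj₂ (refl , refl)
  arc-false⁻ o (suc e , t , h)       = inj₁ (e , t , h)

  arc-false⁺ : ∀ o → Adjoin (Arc G∖e o) b a ⇒ Arc G (false ∷ o)
  arc-false⁺ o (inj₁ (e , t , h))    = suc e , t , h
  arc-false⁺ o (inj₂ (refl , refl)) = zero , refl , refl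

  closedWalk-delete : ∀ s o → ClosedWalk (Arc G∖e o) → ClosedWalk (Arc G (s ∷ o))
  closedWalk-delete s o = closedWalk-map λ (e , t , h) → suc e , t , h

  loop⇒closedWalk : a ≡ b → ∀ s o → ClosedWalk (Arc G (s ∷ o))
  loop⇒closedWalk a≡b true  o = a , b , (zero , refl , refl) , subst (Star _ b) (sym a≡b) ε
  loop⇒closedWalk a≡b false o = b , a , (zero , refl , refl) , subst (Star _ a) a≡b ε

  module _ (o : Vec Bool m) where

    closedWalk-true : ClosedWalk (Arc G (true ∷ o)) → ClosedWalk (Arc G∖e o) ⊎ Star (Arc G∖e o) b a
    closedWalk-true w = closedWalk-adjoin⁻ (closedWalk-map (arc-true⁻ o) w)

    closedWalk-false : ClosedWalk (Arc G (false ∷ o)) → ClosedWalk (Arc G∖e o) ⊎ Star (Arc G∖e o) a b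
    closedWalk-false w = closedWalk-adjoin⁻ (closedWalk-map (arc-false⁻ o) w)

    path-ba⇒closedWalk : Star (Arc G∖e o) b a → ClosedWalk (Arc G (true ∷ o))
    path-ba⇒closedWalk s = closedWalk-map (arc-true⁺ o) (closedWalk-adjoin⁺ s)

    path-ab⇒closedWalk : Star (Arc G∖e o) a b → ClosedWalk (Arc G (false ∷ o))
    path-ab⇒closedWalk s = closedWalk-map (arc-false⁺ o) (closedWalk-adjoin⁺ s)

  module _ (o : Vec Bool m) where

    sink-delete : ∀ {s v} → IsSink G (s ∷ o) v → IsSink G∖e o v
    sink-delete sink e = sink (suc e)

    -- The first edge points from `a` to `b`, so the only vertex that it can stop from being a sink
    -- is its tail `a`.
    sink-true : ∀ {v} → v ≢ a → IsSink G (true ∷ o) v ⇔ IsSink G∖e o v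
    sink-true v≢a = mk⇔ sink-delete λ where
      sink zero    (inj₁ v≡a) → contradiction v≡a v≢a
      sink zero    (inj₂ v≡b) → sym v≡b
      sink (suc e) inc        → sink e inc

    sink-false : ∀ {v} → v ≢ b → IsSink G (false ∷ o) v ⇔ IsSink G∖e o v
    sink-false v≢b = mk⇔ sink-delete λ where
      sink zero    (inj₁ v≡a) → sym v≡a
      sink zero    (inj₂ v≡b) → contradiction v≡b v≢b
      sink (suc e) inc        → sink e inc

    module _ (a≢b : a ≢ b) where

      ¬sink-true : ¬ IsSink G (true ∷ o) a
      ¬sink-true sink = a≢b (sym (sink zero (inj₁ refl)))

      ¬sink-false : ¬ IsSink G (false ∷ o) b
      ¬sink-false sink = a≢b (sink zero (inj₂ refl))

  module Contract (a≢b : a ≢ b) where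
    open Identify a≢b public

    G/e : Graph
    G/e = record { ends = λ e → φ (proj₁ (ends (suc e))) , φ (proj₂ (ends (suc e))) }

    tail/ : ∀ o e → tail G/e o e ≡ φ (tail G∖e o e)
    tail/ o e with lookup o e
    ... | true  = refl
    ... | false = refl

    head/ : ∀ o e → head G/e o e ≡ φ (head G∖e o e)
    head/ o e with lookup o e
    ... | true  = refl
    ... | false = refl

    arc/⁻ : ∀ o → Arc G/e o ⇒ Image (Arc G∖e o)
    arc/⁻ o (e , refl , refl) = _ , _ , (e , refl , refl) , sym (tail/ o e) , sym (head/ o e)

    arc/⁺ : ∀ o → Image (Arc G∖e o) ⇒ Arc G/e o
    arc/⁺ o (_ , _ , (e , refl , refl) , refl , refl) = e , tail/ o e , head/ o e

    module _ (o : Vec Bool m) where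

      closedWalk/⁻ : ClosedWalk (Arc G/e o) →
                     ClosedWalk (Arc G∖e o) ⊎ Star (Arc G∖e o) a b ⊎ Star (Arc G∖e o) b a
      closedWalk/⁻ w = closedWalk-image⁻ (closedWalk-map (arc/⁻ o) w)

      closedWalk/⁺ : ClosedWalk (Arc G∖e o) → ClosedWalk (Arc G/e o)
      closedWalk/⁺ w = closedWalk-map (arc/⁺ o) (closedWalk-image⁺ w)

      path-ab⇒closedWalk/ : Star (Arc G∖e o) a b → ClosedWalk (Arc G/e o)
      path-ab⇒closedWalk/ s =
        closedWalk-map (arc/⁺ o) (path⇒closedWalk-image a≢b (trans φ-a (sym φ-b)) s)

      path-ba⇒closedWalk/ : Star (Arc G∖e o) b a → ClosedWalk (Arc G/e o)
      path-ba⇒closedWalk/ s =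
        closedWalk-map (arc/⁺ o) (path⇒closedWalk-image (a≢b ∘ sym) (trans φ-b (sym φ-a)) s)

      incident/ : ∀ {v e} → v ≢ a → v ≢ b → Incident G/e v e ⇔ Incident G∖e v e
      incident/ {v} {e} v≢a v≢b = mk⇔
        (Sum.map (fibre (proj₁ (ends (suc e)))) (fibre (proj₂ (ends (suc e)))))
        (Sum.map (λ { refl → sym (φ-≢ v≢b) }) (λ { refl → sym (φ-≢ v≢b) }))
        where
        fibre : ∀ u → v ≡ φ u → v ≡ u
        fibre u eq = sym (φ⁻¹ {u} v≢a (sym eq))

      sink/ : ∀ {v} → v ≢ a → v ≢ b → IsSink G/e o v ⇔ IsSink G∖e o v
      sink/ v≢a v≢b = mk⇔
        (λ sink e inc → φ⁻¹ v≢a (trans (sym (head/ o e)) (sink e (Equivalence.from (incident/ v≢a v≢b) inc))))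
        (λ sink e inc → trans (head/ o e)
          (trans (cong φ (sink e (Equivalence.to (incident/ v≢a v≢b) inc))) (φ-≢ v≢b)))

      sink/-b : IsSink G/e o b
      sink/-b e (inj₁ eq) = contradiction (sym eq) (φ≢b {proj₁ (ends (suc e))})
      sink/-b e (inj₂ eq) = contradiction (sym eq) (φ≢b {proj₂ (ends (suc e))})

      -- Acyclicity turns sinks into vertices without outgoing arcs, and the arcs leaving the merged
      -- `a` are the images of those leaving `a` or `b`. It is essential for an edge parallel to the
      -- contracted one: that edge becomes a loop at `a`, which `IsSink` alone would tolerate.
      sink/-a : Acyclic G/e o → IsSink G/e o a ⇔ (IsSink G∖e o a × IsSink G∖e o b)
      sink/-a acyc/ = mk⇔
        (λ sink → let noOut = sink⇒noOut G/e o acyc/ sink in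
          noOut⇒sink G∖e o (λ w r → noOut (φ w) (arc/⁺ o (_ , _ , r , φ-a , refl))) ,
          noOut⇒sink G∖e o (λ w r → noOut (φ w) (arc/⁺ o (_ , _ , r , φ-b , refl))))
        (λ (sink-a , sink-b) → noOut⇒sink G/e o λ w arc →
          let u , v , r , φu≡a , _ = arc/⁻ o arc in
          noOut-ends sink-a sink-b (φ-a⁻¹ φu≡a) v r)
        where
        acyc : Acyclic G∖e o
        acyc = acyclic⁺ G∖e o (λ w → acyclic⁻ G/e o acyc/ (closedWalk/⁺ w))
        noOut-ends : IsSink G∖e o a → IsSink G∖e o b → ∀ {u} → Ends u → NoOut (Arc G∖e o) u
        noOut-ends sink-a sink-b (inj₁ refl) = sink⇒noOut G∖e o acyc sink-a
        noOut-ends sink-a sink-b (inj₂ refl) = sink⇒noOut G∖e o acyc sink-b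

-- Subsets and lists of components.

unique∧set⇒↭ : {A : Set} {xs ys : List A} → Unique xs → Unique ys →
               (∀ {x} → x ∈ xs ⇔ x ∈ ys) → xs ↭ ys
unique∧set⇒↭ uxs uys xs⇔ys = ∼bag⇒↭ (unique∧set⇒bag uxs uys xs⇔ys)

∈-subsets : ∀ {n} (S : Subset n) → S ∈ subsets n
∈-subsets []          = here refl
∈-subsets (false ∷ S) = ∈-++⁺ˡ (∈-map⁺ (false ∷_) (∈-subsets S))
∈-subsets (true ∷ S)  = ∈-++⁺ʳ (map (false ∷_) (subsets _)) (∈-map⁺ (true ∷_) (∈-subsets S))

subsets-unique : ∀ n → Unique (subsets n)
subsets-unique zero    = [] ∷ []
subsets-unique (suc n) = Unique.++⁺
  (Unique.map⁺ Vec.∷-injectiveʳ (subsets-unique n))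
  (Unique.map⁺ Vec.∷-injectiveʳ (subsets-unique n))
  λ (∈false , ∈true) → disjoint (∈-map⁻ (false ∷_) ∈false) (∈-map⁻ (true ∷_) ∈true)
  where
  disjoint : ∀ {S : Subset (suc n)} {P Q : Subset n → Set} →
             ∃ (λ T → P T × S ≡ false ∷ T) → ¬ ∃ (λ T → Q T × S ≡ true ∷ T)
  disjoint (_ , _ , refl) (_ , _ , ())

module _ {n : ℕ} where

  does-∈? : ∀ v (C : Subset n) → does (v ∈? C) ≡ lookup C v
  does-∈? v C with v ∈? C
  ... | yes v∈C = sym (Vec.[]=⇒lookup v∈C)
  ... | no v∉C with lookup C v in eq
  ...   | true  = contradiction (Vec.lookup⇒[]= v C eq) v∉C
  ...   | false = refl

  lookup-⇔ : ∀ {v w} {C D : Subset n} → (v ∈ˢ C ⇔ w ∈ˢ D) → lookup C v ≡ lookup D w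
  lookup-⇔ {v} {w} {C} {D} eqv with lookup C v in eqC | lookup D w in eqD
  ... | true  | true  = refl
  ... | false | false = refl
  ... | true  | false = trans (sym (Vec.[]=⇒lookup (Equivalence.to eqv (Vec.lookup⇒[]= v C eqC)))) eqD
  ... | false | true  = trans (sym eqC) (Vec.[]=⇒lookup (Equivalence.from eqv (Vec.lookup⇒[]= w D eqD)))

  ⇔-lookup : ∀ {v w} {C D : Subset n} → lookup C v ≡ lookup D w → v ∈ˢ C ⇔ w ∈ˢ D
  ⇔-lookup {v} {w} {C} {D} eq = mk⇔
    (λ v∈ → Vec.lookup⇒[]= w D (trans (sym eq) (Vec.[]=⇒lookup v∈)))
    (λ w∈ → Vec.lookup⇒[]= v C (trans eq (Vec.[]=⇒lookup w∈)))

  ∉⇒lookup : ∀ {v} {C : Subset n} → ¬ (v ∈ˢ C) → lookup C v ≡ false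
  ∉⇒lookup {v} {C} v∉ = trans (sym (does-∈? v C)) (dec-false (v ∈? C) v∉)

  module _ (a b : Fin n) where

    -- A component of a graph with an edge ab contains both or neither of a and b,
    -- so this removes b from it.  Unlike plain removal it is injective on all subsets.
    toggle : Subset n → Subset n
    toggle C = C [ b ]≔ (lookup C b xor lookup C a)

    lookup-toggle-b : ∀ C → lookup (toggle C) b ≡ lookup C b xor lookup C a
    lookup-toggle-b C = Vec.lookup∘updateAt b C

    lookup-toggle : ∀ C {v} → v ≢ b → lookup (toggle C) v ≡ lookup C v
    lookup-toggle C {v} v≢b = Vec.lookup∘updateAt′ v b v≢b C

    -- The bit at `a` survives the first toggle, as `a` differs from `b`, so the second one xors the
    -- same bit into `b` again.
    toggle-involutive : a ≢ b → ∀ C → toggle (toggle C) ≡ C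
    toggle-involutive a≢b C = begin
      toggle C [ b ]≔ (lookup (toggle C) b xor lookup (toggle C) a)
        ≡⟨ cong (toggle C [ b ]≔_) (cong₂ _xor_ (lookup-toggle-b C) (lookup-toggle C a≢b)) ⟩
      toggle C [ b ]≔ ((lookup C b xor lookup C a) xor lookup C a)
        ≡⟨ Vec.[]≔-idempotent C b ⟩
      C [ b ]≔ ((lookup C b xor lookup C a) xor lookup C a)
        ≡⟨ cong (C [ b ]≔_) (cancel (lookup C b) (lookup C a)) ⟩
      C [ b ]≔ lookup C b
        ≡⟨ Vec.[]≔-lookup C b ⟩
      C ∎
      where
      open ≡-Reasoning
      cancel : ∀ x y → (x xor y) xor y ≡ x
      cancel x y = trans (Bool.xor-assoc x y y)
        (trans (cong (x xor_) (Bool.xor-same y)) (Bool.xor-identityʳ x))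

    toggle-injective : a ≢ b → ∀ {C D} → toggle C ≡ toggle D → C ≡ D
    toggle-injective a≢b {C} {D} eq =
      trans (sym (toggle-involutive a≢b C)) (trans (cong toggle eq) (toggle-involutive a≢b D))

module _ (G : Graph) (S : Subset (Graph.m G)) where
  open Graph G

  connected-sym : ∀ {u v} → Connected G S u v → Connected G S v u
  connected-sym = EqClosure.symmetric _

  ∈-𝒞⁺ : ∀ {C} → IsComponent G S C → C ∈ 𝒞 G S
  ∈-𝒞⁺ {C} = ∈-filter⁺ (isComponent? G S) (∈-subsets C)

  ∈-𝒞⁻ : ∀ {C} → C ∈ 𝒞 G S → IsComponent G S C
  ∈-𝒞⁻ C∈ = proj₂ (∈-filter⁻ (isComponent? G S) {xs = subsets d} C∈)

  𝒞-unique : Unique (𝒞 G S)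
  𝒞-unique = Unique.filter⁺ (isComponent? G S) (subsets-unique d)

  component-closed : ∀ {C u v} → IsComponent G S C → Connected G S u v → u ∈ˢ C ⇔ v ∈ˢ C
  component-closed (r , r~) u~v = mk⇔
    (λ u∈ → Equivalence.from (r~ _) (Equivalence.to (r~ _) u∈ ◅◅ u~v))
    (λ v∈ → Equivalence.from (r~ _) (Equivalence.to (r~ _) v∈ ◅◅ connected-sym u~v))

-- Both lists filter the same `subsets d`, so equivalent connectedness relations give equal lists
-- and not just permuted ones.
𝒞-cong : ∀ {d m m′} (ends : Fin m → Fin d × Fin d) (ends′ : Fin m′ → Fin d × Fin d) S S′ →
         let G = record { ends = ends } ; G′ = record { ends = ends′ } in
         (∀ {u v} → Connected G S u v ⇔ Connected G′ S′ u v) → 𝒞 G S ≡ 𝒞 G′ S′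
𝒞-cong {d} ends ends′ S S′ conn =
  List.filter-≐ (isComponent? _ S) (isComponent? _ S′)
    ( (λ (v , iff) → v , λ w → mk⇔
        (Equivalence.to conn ∘ Equivalence.to (iff w)) (Equivalence.from (iff w) ∘ Equivalence.from conn))
    , (λ (v , iff) → v , λ w → mk⇔
        (Equivalence.from conn ∘ Equivalence.to (iff w)) (Equivalence.from (iff w) ∘ Equivalence.to conn)))
    (subsets d)

-- Components under deletion and contraction of the first edge.

module FirstEdgeComponents {d m : ℕ} (ends : Fin (suc m) → Fin d × Fin d) where
  open FirstEdge ends

  module _ (S : Subset m) where

    adjacent-suc : ∀ s → Adjacent G∖e S ⇒ Adjacent G (s ∷ S)
    adjacent-suc s (e , e∈S , eq) = suc e , Vec.there e∈S , eq

    connected-delete : ∀ {u v} → Connected G (false ∷ S) u v ⇔ Connected G∖e S u v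
    connected-delete = mk⇔
      (EqClosure.map λ { (suc e , Vec.there e∈S , eq) → e , e∈S , eq })
      (EqClosure.map (adjacent-suc false))

    connected-loop : a ≡ b → ∀ {u v} → Connected G (true ∷ S) u v ⇔ Connected G∖e S u v
    connected-loop a≡b = mk⇔
      (EqClosure._⋆ λ { (zero , _ , refl) → subst (Connected G∖e S a) a≡b ε
                      ; (suc e , Vec.there e∈S , eq) → EqClosure.return (e , e∈S , eq) })
      (EqClosure.map (adjacent-suc true))

    𝒞-delete : 𝒞 G (false ∷ S) ≡ 𝒞 G∖e S
    𝒞-delete = 𝒞-cong ends (ends ∘ suc) (false ∷ S) S connected-delete

    𝒞-loop : a ≡ b → 𝒞 G (true ∷ S) ≡ 𝒞 G∖e S
    𝒞-loop a≡b = 𝒞-cong ends (ends ∘ suc) (true ∷ S) S (connected-loop a≡b)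

    module _ (a≢b : a ≢ b) where
      open Contract a≢b

      private
        _~_ _~/_ : Rel (Fin d) 0ℓ
        _~_  = Connected G (true ∷ S)
        _~/_ = Connected G/e S

      a~b : a ~ b
      a~b = EqClosure.return (zero , Vec.here , refl)

      φ~ : ∀ v → φ v ~ v
      φ~ v = case (v Fin.≟ b)
        where
        case : Dec (v ≡ b) → φ v ~ v
        case (yes refl) = subst (_~ b) (sym φ-b) a~b
        case (no v≢b)   = subst (_~ v) (sym (φ-≢ v≢b)) ε

      ~⇒~/ : ∀ {u v} → u ~ v → φ u ~/ φ v
      ~⇒~/ = EqClosure.gfold (EqClosure.isEquivalence _) φ λ where
        (zero , _ , refl)            → subst (φ a ~/_) (trans φ-a (sym φ-b)) ε
        (suc e , Vec.there e∈S , refl) → EqClosure.return (e , e∈S , refl)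

      ~/⇒~ : ∀ {u v} → u ~/ v → u ~ v
      ~/⇒~ = EqClosure._⋆ λ where
        (e , e∈S , refl) → φ~ (proj₁ (ends (suc e))) ◅◅
          EqClosure.return (suc e , Vec.there e∈S , refl) ◅◅
          connected-sym G (true ∷ S) (φ~ (proj₂ (ends (suc e))))

      ~/⇒~′ : ∀ {u v} → φ u ~/ φ v → u ~ v
      ~/⇒~′ {u} {v} s = connected-sym G (true ∷ S) (φ~ u) ◅◅ ~/⇒~ s ◅◅ φ~ v

      b-isolated : ∀ {v} → b ~/ v → b ≡ v
      b-isolated ε = refl
      b-isolated (fwd (e , _ , eq) ◅ _) =
        contradiction (cong proj₁ eq) (φ≢b {proj₁ (ends (suc e))})
      b-isolated (bwd (e , _ , eq) ◅ _) =
        contradiction (cong proj₂ eq) (φ≢b {proj₂ (ends (suc e))})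

      component⇒a⇔b : ∀ {C} → IsComponent G (true ∷ S) C → lookup C a ≡ lookup C b
      component⇒a⇔b {C} comp = lookup-⇔ {C = C} {D = C} (component-closed G (true ∷ S) comp a~b)

      ⁅b⁆-component/ : IsComponent G/e S ⁅ b ⁆
      ⁅b⁆-component/ = b , λ w → mk⇔
        (λ w∈ → subst (b ~/_) (sym (Subset.x∈⁅y⁆⇒x≡y b w∈)) ε)
        (λ b~w → subst (_∈ˢ ⁅ b ⁆) (b-isolated b~w) (Subset.x∈⁅x⁆ b))

      toggle-component⁺ : ∀ {C} → IsComponent G (true ∷ S) C → IsComponent G/e S (toggle a b C)
      -- The representative moves to `φ v`, because `v` may be `b`, which the toggled component has
      -- lost.
      toggle-component⁺ {C} comp@(v , v~) = φ v , λ w → iff w (w Fin.≟ b)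
        where
        b∉ : lookup (toggle a b C) b ≡ false
        b∉ = trans (lookup-toggle-b a b C)
          (trans (cong (lookup C b xor_) (component⇒a⇔b comp)) (Bool.xor-same (lookup C b)))
        iff : ∀ w → Dec (w ≡ b) → w ∈ˢ toggle a b C ⇔ φ v ~/ w
        iff w (yes refl) = mk⇔
          (λ b∈ → contradiction (trans (sym (Vec.[]=⇒lookup b∈)) b∉) λ ())
          (λ s → contradiction (sym (b-isolated (connected-sym G/e S s))) (φ≢b {v}))
        iff w (no w≢b) = mk⇔
          (λ w∈ → subst (φ v ~/_) (φ-≢ w≢b)
            (~⇒~/ (Equivalence.to (v~ w) (Equivalence.to same w∈))))
          (λ s → Equivalence.from same (Equivalence.from (v~ w)
            (~/⇒~′ (subst (φ v ~/_) (sym (φ-≢ w≢b)) s))))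
          where
          same : w ∈ˢ toggle a b C ⇔ w ∈ˢ C
          same = ⇔-lookup {C = toggle a b C} {D = C} (lookup-toggle a b C w≢b)

      component/⁻ : ∀ {D} → IsComponent G/e S D → D ≡ ⁅ b ⁆ ⊎ IsComponent G (true ∷ S) (toggle a b D)
      component/⁻ {D} (v , v~) with v Fin.≟ b
      ... | yes refl = inj₁ (Subset.⊆-antisym
        (λ {w} w∈ → subst (_∈ˢ ⁅ b ⁆) (b-isolated (Equivalence.to (v~ w) w∈)) (Subset.x∈⁅x⁆ b))
        (λ {w} w∈ → Equivalence.from (v~ w) (subst (b ~/_) (sym (Subset.x∈⁅y⁆⇒x≡y b w∈)) ε)))
      -- Here `b` lies outside `D`, so toggling adds `b` exactly if `a` lies in `D`: the result is
      -- the preimage of `D` under `φ`.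
      ... | no v≢b = inj₂ (v , λ w → mk⇔
        (λ w∈ → ~/⇒~′ (subst (_~/ φ w) (sym (φ-≢ v≢b))
          (Equivalence.to (v~ (φ w)) (Equivalence.to (φ-∈ w) w∈))))
        (λ s → Equivalence.from (φ-∈ w) (Equivalence.from (v~ (φ w))
          (subst (_~/ φ w) (φ-≢ v≢b) (~⇒~/ s)))))
        where
        b∉ : lookup D b ≡ false
        b∉ = ∉⇒lookup λ b∈ → v≢b (sym (b-isolated (connected-sym G/e S (Equivalence.to (v~ b) b∈))))
        lookup-φ : ∀ w → Dec (w ≡ b) → lookup (toggle a b D) w ≡ lookup D (φ w)
        lookup-φ w (yes refl) = trans (lookup-toggle-b a b D)
          (trans (cong (_xor lookup D a) b∉) (cong (lookup D) (sym φ-b)))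
        lookup-φ w (no w≢b) = trans (lookup-toggle a b D w≢b) (cong (lookup D) (sym (φ-≢ w≢b)))
        φ-∈ : ∀ w → w ∈ˢ toggle a b D ⇔ φ w ∈ˢ D
        φ-∈ w = ⇔-lookup {C = toggle a b D} {D = D} (lookup-φ w (w Fin.≟ b))

      -- The components on the left come in the order of `subsets`, in which `⁅ b ⁆` need not be
      -- first; hence a permutation, obtained from uniqueness and equal membership. The entry
      -- `⁅ b ⁆` is new because toggled components omit `b`.
      𝒞-contract : 𝒞 G/e S ↭ ⁅ b ⁆ ∷ map (toggle a b) (𝒞 G (true ∷ S))
      𝒞-contract = unique∧set⇒↭ (𝒞-unique G/e S)
        (All.tabulate (λ C∈ ⁅b⁆≡C → fresh (∈-map⁻ (toggle a b) (subst (_∈ _) (sym ⁅b⁆≡C) C∈)))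
          ∷ Unique.map⁺ (toggle-injective a b a≢b) (𝒞-unique G (true ∷ S)))
        (mk⇔ to from)
        where
        fresh : ¬ ∃ λ C → C ∈ 𝒞 G (true ∷ S) × ⁅ b ⁆ ≡ toggle a b C
        fresh (C , C∈ , eq) = contradiction
          (trans (sym (Vec.[]=⇒lookup (Subset.x∈⁅x⁆ b))) (trans (cong (λ D → lookup D b) eq)
            (trans (lookup-toggle-b a b C) (trans (cong (lookup C b xor_) (component⇒a⇔b (∈-𝒞⁻ G (true ∷ S) C∈)))
              (Bool.xor-same (lookup C b)))))) λ ()
        to : ∀ {D} → D ∈ 𝒞 G/e S → D ∈ ⁅ b ⁆ ∷ map (toggle a b) (𝒞 G (true ∷ S))
        to {D} D∈ with component/⁻ (∈-𝒞⁻ G/e S D∈)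
        ... | inj₁ refl = here refl
        ... | inj₂ comp = there (subst (_∈ _) (toggle-involutive a b a≢b D)
          (∈-map⁺ (toggle a b) (∈-𝒞⁺ G (true ∷ S) comp)))
        from : ∀ {D} → D ∈ ⁅ b ⁆ ∷ map (toggle a b) (𝒞 G (true ∷ S)) → D ∈ 𝒞 G/e S
        from (here refl) = ∈-𝒞⁺ G/e S ⁅b⁆-component/
        from (there D∈) with ∈-map⁻ (toggle a b) D∈
        ... | C , C∈ , refl = ∈-𝒞⁺ G/e S (toggle-component⁺ (∈-𝒞⁻ G (true ∷ S) C∈))

𝒞-edgeless : ∀ {d} (ends : Fin 0 → Fin d × Fin d) →
             𝒞 (record { ends = ends }) [] ↭ map ⁅_⁆ (allFin d)
𝒞-edgeless {d} ends = unique∧set⇒↭ (𝒞-unique G []) (Unique.map⁺ ⁅⁆-injective (Unique.allFin⁺ d))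
  (mk⇔ to from)
  where
  G : Graph
  G = record { ends = ends }
  ⁅⁆-injective : ∀ {u v : Fin d} → ⁅ u ⁆ ≡ ⁅ v ⁆ → u ≡ v
  ⁅⁆-injective {u} {v} eq = Subset.x∈⁅y⁆⇒x≡y v (subst (u ∈ˢ_) eq (Subset.x∈⁅x⁆ u))
  discrete : ∀ {u v} → Connected G [] u v → u ≡ v
  discrete ε                = refl
  discrete (fwd (() , _) ◅ _)
  discrete (bwd (() , _) ◅ _)
  to : ∀ {C} → C ∈ 𝒞 G [] → C ∈ map ⁅_⁆ (allFin d)
  to {C} C∈ with ∈-𝒞⁻ G [] C∈
  ... | v , v~ = subst (_∈ map ⁅_⁆ (allFin d)) (Subset.⊆-antisym
      (λ {w} w∈ → Equivalence.from (v~ w) (subst (Connected G [] v) (sym (Subset.x∈⁅y⁆⇒x≡y v w∈)) ε))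
      (λ {w} w∈ → subst (_∈ˢ ⁅ v ⁆) (discrete (Equivalence.to (v~ w) w∈)) (Subset.x∈⁅x⁆ v)))
    (∈-map⁺ ⁅_⁆ (∈-allFin v))
  from : ∀ {C} → C ∈ map ⁅_⁆ (allFin d) → C ∈ 𝒞 G []
  from C∈ with ∈-map⁻ ⁅_⁆ C∈
  ... | v , _ , refl = ∈-𝒞⁺ G [] (v , λ w → mk⇔
    (λ w∈ → subst (Connected G [] v) (sym (Subset.x∈⁅y⁆⇒x≡y v w∈)) ε)
    (λ s → subst (_∈ˢ ⁅ v ⁆) (discrete s) (Subset.x∈⁅x⁆ v)))

length-filter-map : {A B : Set} {P : Pred B 0ℓ} (P? : Decidable P) (f : A → B) (xs : List A) →
                    length (filter P? (map f xs)) ≡ length (filter (P? ∘ f) xs)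
length-filter-map P? f []       = refl
length-filter-map P? f (x ∷ xs) with does (P? (f x))
... | true  = cong suc (length-filter-map P? f xs)
... | false = length-filter-map P? f xs

length-elements : ∀ {n} (C : Subset n) → length (elements C) ≡ ∣ C ∣
length-elements []      = refl
length-elements {suc n} (x ∷ C) = head-case x
  where
  rest : ∀ x → length (filter (_∈? (x ∷ C)) (List.tabulate suc)) ≡ ∣ C ∣
  rest x = trans
    (cong (λ vs → length (filter (_∈? (x ∷ C)) vs)) (sym (List.map-tabulate id suc)))
    (trans (length-filter-map (_∈? (x ∷ C)) suc (allFin n))
      (trans (cong length (List.filter-≐ ((_∈? (x ∷ C)) ∘ suc) (_∈? C)
                 (Subset.drop-there , Vec.there) (allFin n)))
        (length-elements C)))
  head-case : ∀ x → length (elements (x ∷ C)) ≡ ∣ x ∷ C ∣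
  head-case true  = cong suc (rest true)
  head-case false = rest false

-- The expansion with weights in a commutative ring.

module Expansion {c ℓ} (R : CommutativeRing c ℓ) where
  open CommutativeRing R renaming (refl to ≈-refl; sym to ≈-sym; trans to ≈-trans)
  open import Relation.Binary.Reasoning.Setoid setoid
  open RingProperties ring using (-1*x≈-x; -‿involutive; -‿distribˡ-*; -0#≈0#; x[y-z]≈xy-xz)
  open CommutativeSemigroupProperties
    (CommutativeMonoid.commutativeSemigroup +-commutativeMonoid)
    using () renaming (x∙yz≈y∙xz to +-exchange)
  open Exp semiring using (_^_)
  open Fold +-commutativeMonoid using ()
    renaming (fold to ∑; fold-cong to ∑-cong; fold-𝟙 to ∑-0; fold-∙ to ∑-+;
              fold-subsets to ∑-subsets; fold-filter to ∑-filter)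
  open Fold *-commutativeMonoid using (_except_)
    renaming (fold to ∏; fold-cong to ∏-cong; fold-cong-∈ to ∏-cong-∈; fold-𝟙 to ∏-1;
              fold-map to ∏-map; fold-↭ to ∏-↭; fold-filter to ∏-filter;
              fold-extract to ∏-extract; fold-extract₂ to ∏-extract₂;
              fold-except-cong to ∏-except-cong)

  x+[1-x]≈1 : ∀ x → x + (1# - x) ≈ 1#
  x+[1-x]≈1 x = begin
    x + (1# - x)     ≈⟨ +-congˡ (+-comm 1# (- x)) ⟩
    x + (- x + 1#)   ≈⟨ +-assoc x (- x) 1# ⟨
    (x - x) + 1#     ≈⟨ +-congʳ (-‿inverseʳ x) ⟩
    0# + 1#          ≈⟨ +-identityˡ 1# ⟩
    1#               ∎

  1-[1-x]≈x : ∀ x → 1# - (1# - x) ≈ x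
  1-[1-x]≈x x = begin
    1# - (1# - x)                 ≈⟨ +-congʳ (x+[1-x]≈1 x) ⟨
    x + (1# - x) - (1# - x)       ≈⟨ +-assoc x (1# - x) _ ⟩
    x + ((1# - x) - (1# - x))     ≈⟨ +-congˡ (-‿inverseʳ (1# - x)) ⟩
    x + 0#                        ≈⟨ +-identityʳ x ⟩
    x                             ∎

  1-0≈1 : 1# - 0# ≈ 1#
  1-0≈1 = ≈-trans (+-congˡ -0#≈0#) (+-identityʳ 1#)

  -- With p = 1 - x and q = 1 - y one has 1 - xy = p + xq, and pq + xq = q. It serves the case in
  -- which both ends of the edge are sinks of the deletion.
  inclusion-exclusion : ∀ x y → (1# - x) + (1# - y) ≈ (1# - x) * (1# - y) + (1# - x * y)
  inclusion-exclusion x y = ≈-sym (begin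
    p * q + (1# - x * y)       ≈⟨ +-congˡ (+-congʳ (≈-trans (+-comm p x) (x+[1-x]≈1 x))) ⟨
    p * q + (p + x - x * y)    ≈⟨ +-congˡ (+-assoc p x _) ⟩
    p * q + (p + (x - x * y))  ≈⟨ +-congˡ (+-congˡ (+-congʳ (*-identityʳ x))) ⟨
    p * q + (p + (x * 1# - x * y)) ≈⟨ +-congˡ (+-congˡ (x[y-z]≈xy-xz x 1# y)) ⟨
    p * q + (p + x * q)        ≈⟨ +-exchange (p * q) p _ ⟩
    p + (p * q + x * q)        ≈⟨ +-congˡ (distribʳ q p x) ⟨
    p + (p + x) * q            ≈⟨ +-congˡ (*-congʳ (≈-trans (+-comm p x) (x+[1-x]≈1 x))) ⟩
    p + 1# * q                 ≈⟨ +-congˡ (*-identityˡ q) ⟩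
    p + q                      ∎)
    where
    p q : Carrier
    p = 1# - x
    q = 1# - y

  sign : ℤ → Carrier
  sign z = (- 1#) ^ ℤ.∣ z ∣

  -- The exponent is an absolute value, which drops when `z` is negative; there a factor -1 is lost
  -- instead of gained, with the same effect. Negative `z` is covered because coranks are handled as
  -- integers, without a proof that they are nonnegative.
  sign-suc : ∀ z → sign (ℤ.1ℤ ℤ.+ z) ≈ - sign z
  sign-suc (+ n)          = -1*x≈-x _
  sign-suc -[1+ zero ]    = ≈-sym (≈-trans (-‿cong (-1*x≈-x 1#)) (-‿involutive 1#))
  sign-suc -[1+ suc n ]   = ≈-sym (≈-trans (-‿cong (-1*x≈-x _)) (-‿involutive _))

  ∏-const : {A : Set} (xs : List A) (x : Carrier) → ∏ xs (const x) ≡ x ^ length xs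
  ∏-const []       x = refl
  ∏-const (_ ∷ xs) x = cong (x *_) (∏-const xs x)

  module _ (G : Graph) where
    open Graph G

    -- A product over all vertices, with 1 at the non-sinks, replaces the product over `Sink`, so
    -- that different orientations and graphs compare factor by factor.
    sinkFactor : (Fin d → Carrier) → Vec Bool m → Fin d → Carrier
    sinkFactor y o v = if does (isSink? G o v) then 1# - y v else 1#

    -- The value 0 at cyclic orientations extends the sum from `𝒜` to all bit vectors, where
    -- dropping the first bit restricts an orientation to the deletion.
    orientationTerm : (Fin d → Carrier) → Vec Bool m → Carrier
    orientationTerm y o = if does (acyclic? G o) then ∏ (allFin d) (sinkFactor y o) else 0#

    subgraphTerm : (Fin d → Carrier) → Subset m → Carrier
    subgraphTerm y S = sign (corank G S) * ∏ (𝒞 G S) (λ C → 1# - ∏ (elements C) y)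

    orientationTerm-acyclic : ∀ y o → Acyclic G o → orientationTerm y o ≡ ∏ (allFin d) (sinkFactor y o)
    orientationTerm-acyclic y o acyc rewrite dec-true (acyclic? G o) acyc = refl

    orientationTerm-cyclic : ∀ y o → ClosedWalk (Arc G o) → orientationTerm y o ≡ 0#
    orientationTerm-cyclic y o w
      rewrite dec-false (acyclic? G o) (λ acyc → acyclic⁻ G o acyc w) = refl

    sinkFactor-sink : ∀ y o {v} → IsSink G o v → sinkFactor y o v ≡ 1# - y v
    sinkFactor-sink y o {v} sink rewrite dec-true (isSink? G o v) sink = refl

    sinkFactor-¬sink : ∀ y o {v} → ¬ IsSink G o v → sinkFactor y o v ≡ 1#
    sinkFactor-¬sink y o {v} ¬sink rewrite dec-false (isSink? G o v) ¬sink = refl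

    ∑-𝒜 : ∀ (x : Fin d → Carrier) → ∑ (𝒜 G) (λ o → ∏ (Sink G o) x) ≈
                                    ∑ (subsets m) (orientationTerm (λ v → 1# - x v))
    ∑-𝒜 x = ≈-trans (∑-filter (acyclic? G) (subsets m) _) (∑-cong (subsets m) term)
      where
      factor : ∀ o v → (if does (isSink? G o v) then x v else 1#) ≈ sinkFactor (λ v → 1# - x v) o v
      factor o v with does (isSink? G o v)
      ... | true  = ≈-sym (1-[1-x]≈x (x v))
      ... | false = ≈-refl
      term : ∀ o → (if does (acyclic? G o) then ∏ (Sink G o) x else 0#) ≈
                   orientationTerm (λ v → 1# - x v) o
      term o with does (acyclic? G o)
      ... | true  = ≈-trans (∏-filter (isSink? G o) (allFin d) x) (∏-cong (allFin d) (factor o))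
      ... | false = ≈-refl

  sinkFactor-cong : ∀ {d m m′} (ends : Fin m → Fin d × Fin d) (ends′ : Fin m′ → Fin d × Fin d) →
    let G = record { ends = ends } ; G′ = record { ends = ends′ } in
    ∀ (y y′ : Fin d → Carrier) o o′ v → IsSink G o v ⇔ IsSink G′ o′ v → y v ≈ y′ v →
    sinkFactor G y o v ≈ sinkFactor G′ y′ o′ v
  sinkFactor-cong ends ends′ y y′ o o′ v sink⇔ y≈
    rewrite does-⇔ sink⇔ (isSink? (record { ends = ends }) o v) (isSink? (record { ends = ends′ }) o′ v)
    with does (isSink? (record { ends = ends′ }) o′ v)
  ... | true  = +-congˡ (-‿cong y≈)
  ... | false = ≈-refl

  ∏-elements : ∀ {n} (C : Subset n) (y : Fin n → Carrier) →
               ∏ (elements C) y ≈ ∏ (allFin n) (λ v → if lookup C v then y v else 1#)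
  ∏-elements C y = ≈-trans (∏-filter (_∈? C) (allFin _) y)
    (∏-cong (allFin _) λ v → reflexive (cong (if_then y v else 1#) (does-∈? v C)))

  ∏-⁅⁆ : ∀ {n} (u : Fin n) (y : Fin n → Carrier) → ∏ (elements ⁅ u ⁆) y ≈ y u
  ∏-⁅⁆ {n} u y = begin
    ∏ (elements ⁅ u ⁆) y                       ≈⟨ ∏-elements ⁅ u ⁆ y ⟩
    ∏ (allFin n) f                             ≈⟨ ∏-extract (allFin n) f (Unique.allFin⁺ n) (∈-allFin u) ⟩
    f u * ∏ (allFin n) (f except u)            ≈⟨ *-cong (reflexive f-u) (∏-1 (allFin n) rest) ⟩
    y u * 1#                                   ≈⟨ *-identityʳ (y u) ⟩
    y u                                        ∎
    where
    f : Fin n → Carrier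
    f v = if lookup ⁅ u ⁆ v then y v else 1#
    f-u : f u ≡ y u
    f-u rewrite trans (sym (does-∈? u ⁅ u ⁆)) (dec-true (u ∈? ⁅ u ⁆) (Subset.x∈⁅x⁆ u)) = refl
    rest : ∀ v → (f except u) v ≈ 1#
    rest v with v Fin.≟ u
    ... | yes _  = ≈-refl
    ... | no v≢u rewrite ∉⇒lookup {C = ⁅ u ⁆} (Subset.x≢y⇒x∉⁅y⁆ v≢u) = ≈-refl

  subgraphTerm-cong : ∀ {d m m′} (ends : Fin m → Fin d × Fin d) (ends′ : Fin m′ → Fin d × Fin d) →
    let G = record { ends = ends } ; G′ = record { ends = ends′ } in
    ∀ y S S′ → ∣ S ∣ ≡ ∣ S′ ∣ → 𝒞 G S ≡ 𝒞 G′ S′ → subgraphTerm G y S ≡ subgraphTerm G′ y S′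
  subgraphTerm-cong {d} ends ends′ y S S′ size≡ 𝒞≡ =
    cong₂ (λ k Cs → sign (+ k ℤ.- + d ℤ.+ + length Cs) * ∏ Cs (λ C → 1# - ∏ (elements C) y)) size≡ 𝒞≡

  -- The deletion-contraction rule for both sides.

  module Step {d m : ℕ} (ends : Fin (suc m) → Fin d × Fin d) (y : Fin d → Carrier) where
    open FirstEdge ends
    open FirstEdgeComponents ends

    subgraphTerm-delete : ∀ S → subgraphTerm G y (false ∷ S) ≡ subgraphTerm G∖e y S
    subgraphTerm-delete S = subgraphTerm-cong ends (ends ∘ suc) y (false ∷ S) S refl (𝒞-delete S)

    module _ (a≡b : a ≡ b) where

      orientationTerm-loop : ∀ s o → orientationTerm G y (s ∷ o) ≡ 0#
      orientationTerm-loop s o = orientationTerm-cyclic G y (s ∷ o) (loop⇒closedWalk a≡b s o)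

      -- A loop joins nothing: it adds an edge and leaves the components alone, so only the sign
      -- changes and the two subsets cancel.
      subgraphTerm-loop : ∀ S → subgraphTerm G y (true ∷ S) ≈ - subgraphTerm G y (false ∷ S)
      subgraphTerm-loop S = ≈-trans (*-cong sign≈ (reflexive (cong (λ Cs → ∏ Cs _) 𝒞≡)))
                                  (≈-sym (-‿distribˡ-* _ _))
        where
        𝒞≡ : 𝒞 G (true ∷ S) ≡ 𝒞 G (false ∷ S)
        𝒞≡ = trans (𝒞-loop S a≡b) (sym (𝒞-delete S))
        arith : ∀ x y z → (ℤ.1ℤ ℤ.+ x) ℤ.- y ℤ.+ z ≡ ℤ.1ℤ ℤ.+ (x ℤ.- y ℤ.+ z)
        arith = solve-∀
        corank≡ : corank G (true ∷ S) ≡ ℤ.1ℤ ℤ.+ corank G (false ∷ S)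
        corank≡ = trans (cong (λ Cs → + ∣ true ∷ S ∣ ℤ.- + d ℤ.+ + length Cs) 𝒞≡)
          (arith (+ ∣ S ∣) (+ d) (+ length (𝒞 G (false ∷ S))))
        sign≈ : sign (corank G (true ∷ S)) ≈ - sign (corank G (false ∷ S))
        sign≈ = ≈-trans (reflexive (cong sign corank≡)) (sign-suc (corank G (false ∷ S)))

    module _ (a≢b : a ≢ b) where
      open Contract a≢b

      y/ : Fin d → Carrier
      y/ v = if does (v Fin.≟ a) then y a * y b else if does (v Fin.≟ b) then 0# else y v

      y/-a : y/ a ≡ y a * y b
      y/-a rewrite dec-true (a Fin.≟ a) refl = refl

      y/-b : y/ b ≡ 0#
      y/-b rewrite dec-false (b Fin.≟ a) (a≢b ∘ sym) | dec-true (b Fin.≟ b) refl = refl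

      y/-≢ : ∀ {v} → v ≢ a → v ≢ b → y/ v ≡ y v
      y/-≢ {v} v≢a v≢b rewrite dec-false (v Fin.≟ a) v≢a | dec-false (v Fin.≟ b) v≢b = refl

      -- By the condition, `a` and `b` are both in `C` or both outside. If both are in, `toggle`
      -- drops `b` and `y/ a` carries the product `y a * y b`; the value 0 at `b` is never
      -- multiplied in.
      ∏-toggle : ∀ C → lookup C a ≡ lookup C b → ∏ (elements (toggle a b C)) y/ ≈ ∏ (elements C) y
      ∏-toggle C Ca≡Cb = begin
        ∏ (elements (toggle a b C)) y/    ≈⟨ ∏-elements (toggle a b C) y/ ⟩
        ∏ (allFin d) f/                   ≈⟨ ∏-extract₂ f/ a≢b ⟩
        f/ a * (f/ b * M/)                ≈⟨ *-assoc (f/ a) (f/ b) M/ ⟨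
        f/ a * f/ b * M/                  ≈⟨ *-cong ends≈ (∏-except-cong {f = f/} {f} a b rest) ⟩
        f a * f b * M                     ≈⟨ *-assoc (f a) (f b) M ⟩
        f a * (f b * M)                   ≈⟨ ∏-extract₂ f a≢b ⟨
        ∏ (allFin d) f                    ≈⟨ ∏-elements C y ⟨
        ∏ (elements C) y                  ∎
        where
        f f/ : Fin d → Carrier
        f v  = if lookup C v then y v else 1#
        f/ v = if lookup (toggle a b C) v then y/ v else 1#
        M M/ : Carrier
        M  = ∏ (allFin d) ((f except a) except b)
        M/ = ∏ (allFin d) ((f/ except a) except b)
        rest : ∀ v → v ≢ a → v ≢ b → f/ v ≈ f v
        rest v v≢a v≢b rewrite lookup-toggle a b C v≢b | y/-≢ v≢a v≢b = ≈-refl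
        ends≈ : f/ a * f/ b ≈ f a * f b
        ends≈ rewrite lookup-toggle a b C a≢b | lookup-toggle-b a b C | Ca≡Cb | y/-a
          with lookup C b
        ... | true  = *-identityʳ _
        ... | false = ≈-refl

      subgraphTerm-contract : ∀ S → subgraphTerm G y (true ∷ S) ≈ subgraphTerm G/e y/ S
      subgraphTerm-contract S = ≈-sym (*-cong (reflexive (cong sign corank≡)) (begin
        ∏ (𝒞 G/e S) F/
          ≈⟨ ∏-↭ F/ (𝒞-contract S a≢b) ⟩
        F/ ⁅ b ⁆ * ∏ (map (toggle a b) (𝒞 G (true ∷ S))) F/
          ≈⟨ *-cong F/-b (reflexive (∏-map (toggle a b) (𝒞 G (true ∷ S)) F/)) ⟩
        1# * ∏ (𝒞 G (true ∷ S)) (F/ ∘ toggle a b)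
          ≈⟨ *-identityˡ _ ⟩
        ∏ (𝒞 G (true ∷ S)) (F/ ∘ toggle a b)
          ≈⟨ ∏-cong-∈ (𝒞 G (true ∷ S)) (λ {C} C∈ → +-congˡ (-‿cong (∏-toggle C
               (component⇒a⇔b S a≢b (∈-𝒞⁻ G (true ∷ S) C∈))))) ⟩
        ∏ (𝒞 G (true ∷ S)) (λ C → 1# - ∏ (elements C) y) ∎))
        where
        F/ : Subset d → Carrier
        F/ C = 1# - ∏ (elements C) y/
        F/-b : F/ ⁅ b ⁆ ≈ 1#
        F/-b = ≈-trans (+-congˡ (-‿cong (≈-trans (∏-⁅⁆ b y/) (reflexive y/-b)))) 1-0≈1
        length≡ : length (𝒞 G/e S) ≡ suc (length (𝒞 G (true ∷ S)))
        length≡ = trans (↭-length (𝒞-contract S a≢b))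
                          (cong suc (List.length-map (toggle a b) (𝒞 G (true ∷ S))))
        arith : ∀ x y z → x ℤ.- y ℤ.+ (ℤ.1ℤ ℤ.+ z) ≡ (ℤ.1ℤ ℤ.+ x) ℤ.- y ℤ.+ z
        arith = solve-∀
        corank≡ : corank G/e S ≡ corank G (true ∷ S)
        corank≡ = trans (cong (λ k → + ∣ S ∣ ℤ.- + d ℤ.+ + k) length≡)
          (arith (+ ∣ S ∣) (+ d) (+ length (𝒞 G (true ∷ S))))

      module _ (o : Vec Bool m) where

        private
          ϕ : Fin d → Carrier
          ϕ = sinkFactor G∖e y o

          -- The factors of the vertices other than `a` and `b`. They are common to all four terms,
          -- since neither the first edge nor its contraction affects whether such a vertex is a
          -- sink.
          M : Carrier
          M = ∏ (allFin d) ((ϕ except a) except b)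

          split : ∀ (f : Fin d → Carrier) {p q} → f a ≈ p → f b ≈ q →
                  (∀ v → v ≢ a → v ≢ b → f v ≈ ϕ v) → ∏ (allFin d) f ≈ p * q * M
          split f {p} {q} fa fb rest = begin
            ∏ (allFin d) f     ≈⟨ ∏-extract₂ f a≢b ⟩
            f a * (f b * _)    ≈⟨ *-assoc (f a) (f b) _ ⟨
            f a * f b * _      ≈⟨ *-cong (*-cong fa fb) (∏-except-cong {f = f} {ϕ} a b rest) ⟩
            p * q * M          ∎

          true-term : Acyclic G (true ∷ o) → orientationTerm G y (true ∷ o) ≈ ϕ b * M
          true-term acyc = begin
            orientationTerm G y (true ∷ o)
              ≡⟨ orientationTerm-acyclic G y (true ∷ o) acyc ⟩
            ∏ (allFin d) (sinkFactor G y (true ∷ o))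
              ≈⟨ split _ (reflexive (sinkFactor-¬sink G y (true ∷ o) (¬sink-true o a≢b)))
                   (same (a≢b ∘ sym)) (λ v v≢a _ → same v≢a) ⟩
            1# * ϕ b * M
              ≈⟨ *-congʳ (*-identityˡ (ϕ b)) ⟩
            ϕ b * M ∎
            where
            same : ∀ {v} → v ≢ a → sinkFactor G y (true ∷ o) v ≈ ϕ v
            same v≢a = sinkFactor-cong ends (ends ∘ suc) y y (true ∷ o) o _ (sink-true o v≢a) ≈-refl

          false-term : Acyclic G (false ∷ o) → orientationTerm G y (false ∷ o) ≈ ϕ a * M
          false-term acyc = begin
            orientationTerm G y (false ∷ o)
              ≡⟨ orientationTerm-acyclic G y (false ∷ o) acyc ⟩
            ∏ (allFin d) (sinkFactor G y (false ∷ o))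
              ≈⟨ split _ (same a≢b)
                   (reflexive (sinkFactor-¬sink G y (false ∷ o) (¬sink-false o a≢b)))
                   (λ v _ v≢b → same v≢b) ⟩
            ϕ a * 1# * M
              ≈⟨ *-congʳ (*-identityʳ (ϕ a)) ⟩
            ϕ a * M ∎
            where
            same : ∀ {v} → v ≢ b → sinkFactor G y (false ∷ o) v ≈ ϕ v
            same v≢b = sinkFactor-cong ends (ends ∘ suc) y y (false ∷ o) o _ (sink-false o v≢b) ≈-refl

          deleted-term : Acyclic G∖e o → orientationTerm G∖e y o ≈ ϕ a * ϕ b * M
          deleted-term acyc = ≈-trans (reflexive (orientationTerm-acyclic G∖e y o acyc))
            (split ϕ ≈-refl ≈-refl λ _ _ _ → ≈-refl)

          γ : Carrier
          γ = sinkFactor G/e y/ o a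

          contracted-term : Acyclic G/e o → orientationTerm G/e y/ o ≈ γ * M
          contracted-term acyc = begin
            orientationTerm G/e y/ o
              ≡⟨ orientationTerm-acyclic G/e y/ o acyc ⟩
            ∏ (allFin d) (sinkFactor G/e y/ o)
              ≈⟨ split _ ≈-refl ϕ/-b (λ v v≢a v≢b → sinkFactor-cong (Graph.ends G/e) (ends ∘ suc) y/ y o o v
                   (sink/ o v≢a v≢b) (reflexive (y/-≢ v≢a v≢b))) ⟩
            γ * 1# * M
              ≈⟨ *-congʳ (*-identityʳ γ) ⟩
            γ * M ∎
            where
            ϕ/-b : sinkFactor G/e y/ o b ≈ 1#
            ϕ/-b = ≈-trans (reflexive (sinkFactor-sink G/e y/ o (sink/-b o)))
                         (≈-trans (+-congˡ (-‿cong (reflexive y/-b))) 1-0≈1)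

          -- The merged `a` is a sink iff both ends are sinks of the deletion. Only then is `γ`
          -- equal to `1 - y a * y b`; otherwise `γ` and at least one of `ϕ a`, `ϕ b` are 1, and the
          -- identity is trivial.
          ends-identity : Acyclic G/e o → ϕ a + ϕ b ≈ ϕ a * ϕ b + γ
          ends-identity acyc
            rewrite does-⇔ (sink/-a o acyc) (isSink? G/e o a) (isSink? G∖e o a ×-dec isSink? G∖e o b)
                  | y/-a
            with does (isSink? G∖e o a) | does (isSink? G∖e o b)
          ... | true  | true  = inclusion-exclusion (y a) (y b)
          ... | true  | false = +-congʳ (≈-sym (*-identityʳ _))
          ... | false | true  = ≈-trans (+-comm 1# _) (+-congʳ (≈-sym (*-identityˡ _)))
          ... | false | false = +-congʳ (≈-sym (*-identityʳ _))

          path⇒ϕ≡1 : Acyclic G∖e o → ∀ {u v} → u ≢ v → Star (Arc G∖e o) u v → ϕ u ≡ 1#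
          path⇒ϕ≡1 acyc {u} u≢v path =
            sinkFactor-¬sink G∖e y o λ sink → noPath (sink⇒noOut G∖e o acyc sink) u≢v path
            where
            noPath : ∀ {u v} → NoOut (Arc G∖e o) u → u ≢ v → ¬ Star (Arc G∖e o) u v
            noPath noOut u≢v ε       = u≢v refl
            noPath noOut u≢v (r ◅ _) = noOut _ r

        orientationTerm-deletion-contraction :
          orientationTerm G y (false ∷ o) + orientationTerm G y (true ∷ o) ≈
          orientationTerm G∖e y o + orientationTerm G/e y/ o
        orientationTerm-deletion-contraction =
          cases (cycle? arc?) (path? a b) (path? b a)
          where
          arc? : ∀ u v → Dec (Arc G∖e o u v)
          arc? u v = Fin.any? λ e → (tail G∖e o e Fin.≟ u) ×-dec (head G∖e o e Fin.≟ v)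

          path? : ∀ u v → Dec (Star (Arc G∖e o) u v)
          path? = star? arc?

          cases : Dec (Cycle (Arc G∖e o)) → Dec (Star (Arc G∖e o) a b) → Dec (Star (Arc G∖e o) b a) →
                  orientationTerm G y (false ∷ o) + orientationTerm G y (true ∷ o) ≈
                  orientationTerm G∖e y o + orientationTerm G/e y/ o
          -- A cycle of the deletion survives in both extensions and in the contraction, so all four
          -- terms are 0.
          cases (yes cycle) _ _ = reflexive (trans
            (cong₂ _+_ (orientationTerm-cyclic G y (false ∷ o) (closedWalk-delete false o w))
                         (orientationTerm-cyclic G y (true ∷ o) (closedWalk-delete true o w)))
            (sym (cong₂ _+_ (orientationTerm-cyclic G∖e y o w)
                                (orientationTerm-cyclic G/e y/ o (closedWalk/⁺ o w)))))
            where
            w : ClosedWalk (Arc G∖e o)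
            w = cycle⇒closedWalk cycle
          -- The path makes the direction from `b` to `a` and the contraction cyclic. It also starts
          -- with an arc leaving `a`, so `ϕ a` is 1, which supplies the factor missing on the left.
          -- A path back from `b` would contradict acyclicity.
          cases (no acyc) (yes ab) _ = begin
            orientationTerm G y (false ∷ o) + orientationTerm G y (true ∷ o)
              ≈⟨ +-cong (reflexive (orientationTerm-cyclic G y (false ∷ o) (path-ab⇒closedWalk o ab)))
                        (true-term acyc-true) ⟩
            0# + ϕ b * M
              ≈⟨ +-comm 0# _ ⟩
            ϕ b * M + 0#
              ≈⟨ +-congʳ (*-congʳ (*-identityˡ (ϕ b))) ⟨
            1# * ϕ b * M + 0#
              ≈⟨ +-cong (*-congʳ (*-congʳ (reflexive (path⇒ϕ≡1 acyc a≢b ab))))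
                        (reflexive (orientationTerm-cyclic G/e y/ o (path-ab⇒closedWalk/ o ab))) ⟨
            ϕ a * ϕ b * M + orientationTerm G/e y/ o
              ≈⟨ +-congʳ (deleted-term acyc) ⟨
            orientationTerm G∖e y o + orientationTerm G/e y/ o ∎
            where
            acyc-true : Acyclic G (true ∷ o)
            acyc-true = acyclic⁺ G (true ∷ o) λ w →
              [ acyclic⁻ G∖e o acyc , acyclic⇒antisym (acyclic⁻ G∖e o acyc) a≢b ab ] (closedWalk-true o w)
          cases (no acyc) (no ¬ab) (yes ba) = begin
            orientationTerm G y (false ∷ o) + orientationTerm G y (true ∷ o)
              ≈⟨ +-cong (false-term acyc-false)
                        (reflexive (orientationTerm-cyclic G y (true ∷ o) (path-ba⇒closedWalk o ba))) ⟩
            ϕ a * M + 0#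
              ≈⟨ +-congʳ (*-congʳ (*-identityʳ (ϕ a))) ⟨
            ϕ a * 1# * M + 0#
              ≈⟨ +-cong (*-congʳ (*-congˡ (reflexive (path⇒ϕ≡1 acyc (a≢b ∘ sym) ba))))
                        (reflexive (orientationTerm-cyclic G/e y/ o (path-ba⇒closedWalk/ o ba))) ⟨
            ϕ a * ϕ b * M + orientationTerm G/e y/ o
              ≈⟨ +-congʳ (deleted-term acyc) ⟨
            orientationTerm G∖e y o + orientationTerm G/e y/ o ∎
            where
            acyc-false : Acyclic G (false ∷ o)
            acyc-false = acyclic⁺ G (false ∷ o) λ w →
              [ acyclic⁻ G∖e o acyc , ¬ab ] (closedWalk-false o w)
          -- All four graphs are acyclic here; after factoring out `M` only the identity at the two
          -- ends remains.
          cases (no acyc) (no ¬ab) (no ¬ba) = begin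
            orientationTerm G y (false ∷ o) + orientationTerm G y (true ∷ o)
              ≈⟨ +-cong
                   (false-term (acyclic⁺ G (false ∷ o) λ w → [ acyclic⁻ G∖e o acyc , ¬ab ] (closedWalk-false o w)))
                   (true-term (acyclic⁺ G (true ∷ o) λ w → [ acyclic⁻ G∖e o acyc , ¬ba ] (closedWalk-true o w))) ⟩
            ϕ a * M + ϕ b * M
              ≈⟨ distribʳ M (ϕ a) (ϕ b) ⟨
            (ϕ a + ϕ b) * M
              ≈⟨ *-congʳ (ends-identity acyc/) ⟩
            (ϕ a * ϕ b + γ) * M
              ≈⟨ distribʳ M (ϕ a * ϕ b) γ ⟩
            ϕ a * ϕ b * M + γ * M
              ≈⟨ +-cong (deleted-term acyc) (contracted-term acyc/) ⟨
            orientationTerm G∖e y o + orientationTerm G/e y/ o ∎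
            where
            acyc/ : Acyclic G/e o
            acyc/ = acyclic⁺ G/e o λ w →
              [ acyclic⁻ G∖e o acyc , [ ¬ab , ¬ba ] ] (closedWalk/⁻ o w)

  -- Induction on the number of edges, and the two specialisations.

  expansion-edgeless : ∀ {d} (ends : Fin 0 → Fin d × Fin d) y → let G = record { ends = ends } in
                       orientationTerm G y [] ≈ subgraphTerm G y []
  expansion-edgeless {d} ends y = begin
    orientationTerm G y []
      ≡⟨ orientationTerm-acyclic G y [] (acyclic⁺ G [] λ { (_ , _ , (() , _) , _) }) ⟩
    ∏ (allFin d) (sinkFactor G y [])
      -- Without edges every vertex is a sink and a component by itself.
      ≈⟨ ∏-cong (allFin d) (λ v → ≈-trans (reflexive (sinkFactor-sink G y [] λ ()))
           (+-congˡ (-‿cong (≈-sym (∏-⁅⁆ v y))))) ⟩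
    ∏ (allFin d) (λ v → 1# - ∏ (elements ⁅ v ⁆) y)
      ≡⟨ ∏-map ⁅_⁆ (allFin d) _ ⟨
    ∏ (map ⁅_⁆ (allFin d)) (λ C → 1# - ∏ (elements C) y)
      ≈⟨ ∏-↭ _ (𝒞-edgeless ends) ⟨
    ∏ (𝒞 G []) (λ C → 1# - ∏ (elements C) y)
      ≈⟨ *-identityˡ _ ⟨
    1# * ∏ (𝒞 G []) (λ C → 1# - ∏ (elements C) y)
      ≡⟨ cong (λ z → sign z * ∏ (𝒞 G []) (λ C → 1# - ∏ (elements C) y)) corank≡0 ⟨
    subgraphTerm G y [] ∎
    where
    G : Graph
    G = record { ends = ends }
    length≡ : length (𝒞 G []) ≡ d
    length≡ = trans (↭-length (𝒞-edgeless ends))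
      (trans (List.length-map ⁅_⁆ (allFin d)) (List.length-tabulate {n = d} id))
    corank≡0 : corank G [] ≡ ℤ.0ℤ
    corank≡0 = trans (cong (λ k → + 0 ℤ.- + d ℤ.+ + k) length≡) (arith (+ d))
      where
      arith : ∀ x → ℤ.0ℤ ℤ.- x ℤ.+ x ≡ ℤ.0ℤ
      arith = solve-∀

  expansion : ∀ {d} m (ends : Fin m → Fin d × Fin d) y → let G = record { ends = ends } in
              ∑ (subsets m) (orientationTerm G y) ≈ ∑ (subsets m) (subgraphTerm G y)
  -- `subsets 0` has the single entry `[]`, so each sum is one term plus 0.
  expansion zero ends y = +-congʳ (expansion-edgeless ends y)
  expansion (suc m) ends y = begin
    ∑ (subsets (suc m)) (orientationTerm G y)
      ≈⟨ ∑-subsets m (orientationTerm G y) ⟩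
    ∑ (subsets m) (λ o → orientationTerm G y (false ∷ o) + orientationTerm G y (true ∷ o))
      ≈⟨ step (a Fin.≟ b) ⟩
    ∑ (subsets m) (λ S → subgraphTerm G y (false ∷ S) + subgraphTerm G y (true ∷ S))
      ≈⟨ ∑-subsets m (subgraphTerm G y) ⟨
    ∑ (subsets (suc m)) (subgraphTerm G y) ∎
    where
    open FirstEdge ends
    open Step ends y
    step : Dec (a ≡ b) →
      ∑ (subsets m) (λ o → orientationTerm G y (false ∷ o) + orientationTerm G y (true ∷ o)) ≈
      ∑ (subsets m) (λ S → subgraphTerm G y (false ∷ S) + subgraphTerm G y (true ∷ S))
    step (yes a≡b) = ≈-trans
      (∑-0 (subsets m) λ o → ≈-trans (+-cong (reflexive (orientationTerm-loop a≡b false o))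
                                           (reflexive (orientationTerm-loop a≡b true o))) (+-identityˡ 0#))
      (≈-sym (∑-0 (subsets m) λ S → ≈-trans (+-congˡ (subgraphTerm-loop a≡b S)) (-‿inverseʳ _)))
    step (no a≢b) = begin
      ∑ (subsets m) (λ o → orientationTerm G y (false ∷ o) + orientationTerm G y (true ∷ o))
        ≈⟨ ∑-cong (subsets m) (orientationTerm-deletion-contraction a≢b) ⟩
      ∑ (subsets m) (λ o → orientationTerm G∖e y o + orientationTerm G/e (y/ a≢b) o)
        ≈⟨ ∑-+ (subsets m) _ _ ⟩
      ∑ (subsets m) (orientationTerm G∖e y) + ∑ (subsets m) (orientationTerm G/e (y/ a≢b))
        ≈⟨ +-cong (expansion m (ends ∘ suc) y) (expansion m (Graph.ends G/e) (y/ a≢b)) ⟩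
      ∑ (subsets m) (subgraphTerm G∖e y) + ∑ (subsets m) (subgraphTerm G/e (y/ a≢b))
        ≈⟨ ∑-+ (subsets m) _ _ ⟨
      ∑ (subsets m) (λ S → subgraphTerm G∖e y S + subgraphTerm G/e (y/ a≢b) S)
        ≈⟨ ∑-cong (subsets m) (λ S → +-cong (reflexive (subgraphTerm-delete S)) (subgraphTerm-contract a≢b S)) ⟨
      ∑ (subsets m) (λ S → subgraphTerm G y (false ∷ S) + subgraphTerm G y (true ∷ S)) ∎
      where open Contract a≢b using (G/e)

  -- The component weights become 1 - ∏ (1 - x v), which is `vᶜ` when `x` is `var`.
  generating-function : ∀ (G : Graph) (x : Fin (Graph.d G) → Carrier) →
    ∑ (𝒜 G) (λ o → ∏ (Sink G o) x) ≈ ∑ (subsets (Graph.m G)) (subgraphTerm G (λ v → 1# - x v))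
  generating-function G x = ≈-trans (∑-𝒜 G x) (expansion (Graph.m G) (Graph.ends G) _)

  -- The constant weight is inserted before expanding, so no evaluation homomorphism from ℤ[V] to
  -- ℤ[t] is involved; the product over a component collapses to a power.
  generating-function-const : ∀ (G : Graph) (x : Carrier) →
    ∑ (𝒜 G) (λ o → x ^ length (Sink G o)) ≈
    ∑ (subsets (Graph.m G)) (λ S → sign (corank G S) * ∏ (𝒞 G S) (λ C → 1# - (1# - x) ^ ∣ C ∣))
  generating-function-const G x = begin
    ∑ (𝒜 G) (λ o → x ^ length (Sink G o))
      ≈⟨ ∑-cong (𝒜 G) (λ o → reflexive (∏-const (Sink G o) x)) ⟨
    ∑ (𝒜 G) (λ o → ∏ (Sink G o) (const x))
      ≈⟨ generating-function G (const x) ⟩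
    ∑ (subsets (Graph.m G)) (subgraphTerm G (const (1# - x)))
      ≈⟨ ∑-cong (subsets (Graph.m G)) (λ S → *-congˡ {sign (corank G S)} (∏-cong (𝒞 G S) λ C →
           +-congˡ (-‿cong (reflexive (trans (∏-const (elements C) (1# - x))
             (cong ((1# - x) ^_) (length-elements C))))))) ⟩
    ∑ (subsets (Graph.m G)) (λ S → sign (corank G S) * ∏ (𝒞 G S) (λ C → 1# - (1# - x) ^ ∣ C ∣)) ∎

open import Defs

theorem3p2 : (G : Graph) →
    (A[V] G ≈ (∑[ S ← subsets (Graph.m G) ] ([-1]^ corank G S) * (∏[ C ← 𝒞 G S ] vᶜ G C)))
    × (a[t] G ≈ (∑[ S ← subsets (Graph.m G) ] ([-1]^ corank G S) * (∏[ C ← 𝒞 G S ] (1# - (1# - t) ^ ∣ C ∣))))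
theorem3p2 G =
  -- `sumOver`, `prodOver` and `[-1]^_` unfold to the folds and to `sign` over the polynomial ring,
  -- so the statements agree by computation.
  Expansion.generating-function (polynomialRing (Graph.d G)) G var ,
  Expansion.generating-function-const (polynomialRing 1) G t
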